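{- Let $k$ be a finite field with $q$ elements, let $f>0$ be an integer, let $k_f$ be the extension of $k$ of degree $f$, $G_f=\mathrm{Gal}(k_f|k)$, and let $e>0$ be an integer such that $q^f\equiv1\pmod e$. Let $N_f:k_f^\times\to k^\times$ be the norm map. Consider the canonical isomorphism $$H^2(G_f,k_f^\times/k_f^{\times e})_q\to H^2(G_f,{}_ek_f^\times)_q$$ induced by the isomorphism of $G_f$-modules $k_f^\times/k_f^{\times e}\to{}_ek_f^\times$, $\bar\xi\mapsto\xi^{(q^f-1)/e}$. Then for every $\xi\in k_f^\times$ such that $\xi^{q-1}\in k_f^{\times e}$, and every $\alpha\in k_f^\times$ such that $\xi^{q-1}=\alpha^e$, this isomorphism sends the class $[\bar\xi]$ to the class $[\zeta]$ of $\zeta=N_f(\alpha)$.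
   Context: ${}_ek_f^\times$ is the group of $e$-th roots of $1$ in $k_f^\times$. $G_f$ is cyclic, with canonical generator $x\mapsto x^q$. For a $G_f$-module $C$ on which this generator acts by $x\mapsto x^q$, $H^2(G_f,C)_q$ is the kernel of $x\mapsto x^{q-1}$ on $C$ modulo the image of $x\mapsto x^{1+q+\cdots+q^{f-1}}$ on $C$. For $\xi\in k_f^\times$ with $\xi^{q-1}\in k_f^{\times e}$, the image $\bar\xi\in k_f^\times/k_f^{\times e}$ satisfies $\bar\xi^{\,q-1}=1$ and $[\bar\xi]$ is its class in $H^2(G_f,k_f^\times/k_f^{\times e})_q$. If $\xi^{q-1}=\alpha^e$, then $\zeta=N_f(\alpha)$ lies in ${}_ek_f^\times$ and satisfies $\zeta^{q-1}=1$; $[\zeta]$ is its class in $H^2(G_f,{}_ek_f^\times)_q$. -}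

module Defs where

open import Level using (Level; _⊔_) renaming (suc to lsuc)
open import Algebra.Bundles using (AbelianGroup; CommutativeRing; Group)
open import Algebra.Definitions.RawMonoid using () renaming (_×_ to times)
import Algebra.Morphism.Construct.Composition as Compose
import Algebra.Morphism.Construct.Identity as Identity
open import Algebra.Morphism.Structures using (IsGroupIsomorphism; IsRingHomomorphism; IsRingIsomorphism)
import Algebra.Properties.CommutativeMonoid.Sum as MonoidSum
import Algebra.Properties.CommutativeSemiring.Binomial as Binomial
import Algebra.Properties.Semiring.Mult as SemiringMult
import Algebra.Properties.Semiring.Sum as SemiringSum
open import Data.Empty using (⊥-elim)
open import Data.Fin.Base as Fin using (Fin; zero; suc; toℕ; punchIn; punchOut)
import Data.Fin.Properties as Fin
open import Data.List.Base using ([]; _∷_)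
open import Data.List.Relation.Unary.All using (_∷_)
open import Data.Nat.Base as ℕ using (ℕ; zero; suc; NonZero; z≤n; s≤s)
open import Data.Nat.Combinatorics using (nCn≡1) renaming (_C_ to choose)
open import Data.Nat.Coprimality using (Coprime; coprime-Bézout; coprime-divisor) renaming (sym to coprime-sym)
open import Data.Nat.DivMod using (_/_; m*[n/m]≡n)
open import Data.Nat.Divisibility
  using (_∣_; _∣?_; divides; _∣0; 1∣_; ∣-refl; ∣-trans; ∣⇒≤; ∣1⇒≡1; m∣m*n; n∣m*n; *-monoʳ-∣; *-cancelˡ-∣)
open import Data.Nat.GCD using (module Bézout)
open import Data.Nat.Induction using (<-rec)
open import Data.Nat.Primality using (Prime; prime⇒irreducible; prime⇒nonTrivial)
open import Data.Nat.Primality.Factorisation using (factorise; PrimeFactorisation)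
import Data.Nat.Properties as ℕ
open import Data.Product.Base using (∃; _×_; _,_; proj₁; proj₂)
open import Data.Sum.Base using (inj₁; inj₂)
open import Function.Base using (_∘_; id)
open import Function.Bundles using (Inverse)
open import Function.Definitions using (Congruent; Injective)
open import Relation.Binary.Bundles using (Setoid)
open import Relation.Binary.Definitions using (tri<; tri≈; tri>)
open import Relation.Binary.PropositionalEquality.Core as ≡ using (_≡_)
import Relation.Binary.PropositionalEquality.Properties as ≡
import Relation.Binary.Reasoning.Setoid as SetoidReasoning
open import Relation.Nullary using (¬_; Dec; yes; no)
open import Relation.Nullary.Decidable using (map′; ¬?; decidable-stable)

private
  variable
    a b c ℓ ℓ₁ ℓ₂ : Level

infix 4 _HasCardinality_

_HasCardinality_ : Setoid c ℓ → ℕ → Set (c ⊔ ℓ)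
S HasCardinality n = Inverse (≡.setoid (Fin n)) S

Fin-injective⇒surjective : ∀ {n} (h : Fin n → Fin n) → Injective _≡_ _≡_ h →
                           ∀ y → ∃ λ x → h x ≡ y
Fin-injective⇒surjective {suc n} h inj y with Fin.any? (λ x → h x Fin.≟ y)
... | yes found = found
... | no missed = ⊥-elim (ℕ.1+n≰n (Fin.injective⇒≤ {f = λ x → punchOut (avoid x)} out-inj))
  where
  avoid : ∀ x → ¬ y ≡ h x
  avoid x eq = missed (x , ≡.sym eq)
  out-inj : Injective _≡_ _≡_ (λ x → punchOut (avoid x))
  out-inj {x} {x′} eq = inj (Fin.punchOut-injective (avoid x) (avoid x′) eq)

module FiniteSetoid (S : Setoid c ℓ) {n : ℕ} (fin : S HasCardinality n) where
  open Setoid S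
  open Inverse fin using (to; from; inverse)

  enum : Fin n → Carrier
  enum = to

  index : Carrier → Fin n
  index = from

  enum-index : ∀ x → enum (index x) ≈ x
  enum-index x = proj₁ inverse ≡.refl

  index-enum : ∀ i → index (enum i) ≡ i
  index-enum i = proj₂ inverse refl

  index-cong : ∀ {x y} → x ≈ y → index x ≡ index y
  index-cong = Inverse.from-cong fin

  index-injective : ∀ {x y} → index x ≡ index y → x ≈ y
  index-injective {x} {y} eq =
    trans (sym (enum-index x)) (trans (reflexive (≡.cong enum eq)) (enum-index y))

  enum-injective : ∀ {i j} → enum i ≈ enum j → i ≡ j
  enum-injective {i} {j} eq =
    ≡.trans (≡.sym (index-enum i)) (≡.trans (index-cong eq) (index-enum j))

  infix 4 _≟_
  _≟_ : ∀ x y → Dec (x ≈ y)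
  x ≟ y = map′ index-injective index-cong (index x Fin.≟ index y)

  search : {P : Carrier → Set ℓ₁} → (∀ {x y} → x ≈ y → P x → P y) →
           (∀ x → Dec (P x)) → Dec (∃ P)
  search resp P? = map′ (λ (i , pi) → enum i , pi)
                        (λ (x , px) → index x , resp (sym (enum-index x)) px)
                        (Fin.any? (λ i → P? (enum i)))

  injective⇒surjective : (h : Carrier → Carrier) → Congruent _≈_ _≈_ h →
                         Injective _≈_ _≈_ h → ∀ y → ∃ λ x → h x ≈ y
  injective⇒surjective h h-cong h-inj y
    with i , eq ← Fin-injective⇒surjective (index ∘ h ∘ enum)
                    (enum-injective ∘ h-inj ∘ index-injective) (index y)
    = enum i , index-injective eq

open MonoidSum ℕ.+-0-commutativeMonoid using () renaming (sum to sumℕ)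

module Powers (A : AbelianGroup c ℓ) where
  open AbelianGroup A
  open import Algebra.Properties.CommutativeMonoid.Mult commutativeMonoid
    using () renaming (_×_ to mult; ×-congʳ to mult-congʳ; ×-homo-+ to mult-homo-+;
                       ×-assocˡ to mult-assocˡ; ×-distrib-+ to mult-distrib-+)
  open import Algebra.Properties.AbelianGroup A using (inverseˡ-unique)
  open SetoidReasoning setoid

  infixr 8 _^_
  _^_ : Carrier → ℕ → Carrier
  x ^ n = mult n x

  ^-cong : ∀ n {x y} → x ≈ y → x ^ n ≈ y ^ n
  ^-cong = mult-congʳ

  ^-reflexive : ∀ x {m n} → m ≡ n → x ^ m ≈ x ^ n
  ^-reflexive x ≡.refl = refl

  ^-+ : ∀ x m n → x ^ (m ℕ.+ n) ≈ x ^ m ∙ x ^ n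
  ^-+ = mult-homo-+

  ^-* : ∀ x m n → (x ^ m) ^ n ≈ x ^ (m ℕ.* n)
  ^-* x m n = trans (mult-assocˡ x n m) (^-reflexive x (ℕ.*-comm n m))

  ^-^-comm : ∀ x m n → (x ^ m) ^ n ≈ (x ^ n) ^ m
  ^-^-comm x m n = trans (^-* x m n) (trans (^-reflexive x (ℕ.*-comm m n)) (sym (^-* x n m)))

  ^-∙ : ∀ x y n → (x ∙ y) ^ n ≈ x ^ n ∙ y ^ n
  ^-∙ = mult-distrib-+

  ^-1 : ∀ x → x ^ 1 ≈ x
  ^-1 = identityʳ

  ε^ : ∀ n → ε ^ n ≈ ε
  ε^ zero    = refl
  ε^ (suc n) = trans (identityˡ _) (ε^ n)

  ^-⁻¹ : ∀ x n → (x ⁻¹) ^ n ≈ (x ^ n) ⁻¹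
  ^-⁻¹ x n = inverseˡ-unique _ _ (begin
    (x ⁻¹) ^ n ∙ x ^ n  ≈⟨ ^-∙ (x ⁻¹) x n ⟨
    (x ⁻¹ ∙ x) ^ n      ≈⟨ ^-cong n (inverseˡ x) ⟩
    ε ^ n               ≈⟨ ε^ n ⟩
    ε                   ∎)

  ^-∣ : ∀ x {m n} → m ∣ n → x ^ m ≈ ε → x ^ n ≈ ε
  ^-∣ x {m} (divides t ≡.refl) eq = begin
    x ^ (t ℕ.* m)  ≈⟨ ^-reflexive x (ℕ.*-comm t m) ⟩
    x ^ (m ℕ.* t)  ≈⟨ ^-* x m t ⟨
    (x ^ m) ^ t    ≈⟨ ^-cong t eq ⟩
    ε ^ t          ≈⟨ ε^ t ⟩
    ε              ∎

  ^-coprime : ∀ x {m n} → Coprime m n → x ^ m ≈ ε → x ^ n ≈ ε → x ≈ ε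
  ^-coprime x {m} {n} cop xm xn with coprime-Bézout cop
  ... | Bézout.+- s t eq = begin
    x                    ≈⟨ ^-1 x ⟨
    x ^ 1                ≈⟨ identityʳ _ ⟨
    x ^ 1 ∙ ε            ≈⟨ ∙-congˡ (^-∣ x (divides t ≡.refl) xn) ⟨
    x ^ 1 ∙ x ^ (t ℕ.* n)  ≈⟨ ^-+ x 1 (t ℕ.* n) ⟨
    x ^ (1 ℕ.+ t ℕ.* n)  ≈⟨ ^-reflexive x eq ⟩
    x ^ (s ℕ.* m)        ≈⟨ ^-∣ x (divides s ≡.refl) xm ⟩
    ε                    ∎
  ... | Bézout.-+ s t eq = begin
    x                    ≈⟨ ^-1 x ⟨
    x ^ 1                ≈⟨ identityʳ _ ⟨
    x ^ 1 ∙ ε            ≈⟨ ∙-congˡ (^-∣ x (divides s ≡.refl) xm) ⟨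
    x ^ 1 ∙ x ^ (s ℕ.* m)  ≈⟨ ^-+ x 1 (s ℕ.* m) ⟨
    x ^ (1 ℕ.+ s ℕ.* m)  ≈⟨ ^-reflexive x eq ⟩
    x ^ (t ℕ.* n)        ≈⟨ ^-∣ x (divides t ≡.refl) xn ⟩
    ε                    ∎

  open import Algebra.Properties.CommutativeMonoid.Sum commutativeMonoid
    using () renaming (sum to product)

  product-^ : ∀ x n (t : Fin n → ℕ) → product (λ i → x ^ t i) ≈ x ^ sumℕ t
  product-^ x zero    t = refl
  product-^ x (suc n) t = trans (∙-congˡ (product-^ x n (t ∘ suc))) (sym (^-+ x (t zero) _))

module FiniteAbelianGroup (A : AbelianGroup c ℓ) {N : ℕ}
                          (fin : AbelianGroup.setoid A HasCardinality N) where
  open AbelianGroup A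
  open Powers A
  open FiniteSetoid setoid fin
  open import Algebra.Properties.CommutativeMonoid.Sum commutativeMonoid
    using (sum; sum-permute; ∑-distrib-+; sum-cong-≋; sum-replicate)
  open import Algebra.Properties.Group group using (∙-cancelʳ)
  open import Data.Fin.Permutation using (Permutation; permutation)
  open SetoidReasoning setoid

  translation : Carrier → Permutation N N
  translation x = permutation
    (λ i → index (x ∙ enum i)) (λ i → index (x ⁻¹ ∙ enum i))
    (λ i → ≡.trans (index-cong (trans (∙-congˡ (enum-index _))
                     (trans (sym (assoc _ _ _)) (trans (∙-congʳ (inverseʳ x)) (identityˡ _)))))
                   (index-enum i))
    (λ i → ≡.trans (index-cong (trans (∙-congˡ (enum-index _))
                     (trans (sym (assoc _ _ _)) (trans (∙-congʳ (inverseˡ x)) (identityˡ _)))))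
                   (index-enum i))

  lagrange : ∀ x → x ^ N ≈ ε
  lagrange x = ∙-cancelʳ (sum enum) _ _ (begin
    x ^ N ∙ sum enum                         ≈⟨ ∙-congʳ (sum-replicate N) ⟨
    sum {N} (λ _ → x) ∙ sum enum             ≈⟨ ∑-distrib-+ (λ _ → x) enum ⟨
    sum (λ i → x ∙ enum i)                   ≈⟨ sum-cong-≋ (λ i → enum-index (x ∙ enum i)) ⟨
    sum (λ i → enum (index (x ∙ enum i)))    ≈⟨ sum-permute enum (translation x) ⟨
    sum enum                                 ≈⟨ identityˡ _ ⟨
    ε ∙ sum enum                             ∎)

record Field c ℓ : Set (lsuc (c ⊔ ℓ)) where
  field
    commutativeRing : CommutativeRing c ℓ
  open CommutativeRing commutativeRing public hiding (zero)
  field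
    1≉0        : ¬ 1# ≈ 0#
    invertible : ∀ x → ¬ x ≈ 0# → ∃ λ y → x * y ≈ 1#

  open import Algebra.Properties.Semiring.Exp semiring public
    using (_^_; ^-congˡ)

  *-cancelˡ-nonzero : ∀ {x y z} → ¬ x ≈ 0# → x * y ≈ x * z → y ≈ z
  *-cancelˡ-nonzero {x} {y} {z} x≉0 eq with x⁻¹ , inv ← invertible x x≉0 = begin
    y              ≈⟨ *-identityˡ y ⟨
    1# * y         ≈⟨ *-congʳ (trans (*-comm _ _) inv) ⟨
    x⁻¹ * x * y    ≈⟨ *-assoc _ _ _ ⟩
    x⁻¹ * (x * y)  ≈⟨ *-congˡ eq ⟩
    x⁻¹ * (x * z)  ≈⟨ *-assoc _ _ _ ⟨
    x⁻¹ * x * z    ≈⟨ *-congʳ (trans (*-comm _ _) inv) ⟩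
    1# * z         ≈⟨ *-identityˡ z ⟩
    z              ∎
    where open SetoidReasoning setoid

  x*y≈0⇒y≈0 : ∀ {x y} → ¬ x ≈ 0# → x * y ≈ 0# → y ≈ 0#
  x*y≈0⇒y≈0 x≉0 eq = *-cancelˡ-nonzero x≉0 (trans eq (sym (zeroʳ _)))

  *-nonzero : ∀ {x y} → ¬ x ≈ 0# → ¬ y ≈ 0# → ¬ x * y ≈ 0#
  *-nonzero x≉0 y≉0 eq = y≉0 (x*y≈0⇒y≈0 x≉0 eq)

  inverse-nonzero : ∀ {x y} → x * y ≈ 1# → ¬ y ≈ 0#
  inverse-nonzero inv y≈0 = 1≉0 (trans (sym inv) (trans (*-congˡ y≈0) (zeroʳ _)))

  *-cancel-nonzero : ∀ {x y z} → ¬ x ≈ y → x * z ≈ y * z → z ≈ 0#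
  *-cancel-nonzero {x} {y} {z} x≉y eq =
    x*y≈0⇒y≈0 (x≉y ∘ x∙y⁻¹≈ε⇒x≈y _ _) (begin
      (x - y) * z      ≈⟨ distribʳ z x (- y) ⟩
      x * z + - y * z  ≈⟨ +-cong eq (sym (-‿distribˡ-* y z)) ⟩
      y * z - y * z    ≈⟨ -‿inverseʳ _ ⟩
      0#               ∎)
    where
    open SetoidReasoning setoid
    open import Algebra.Properties.Ring ring using (-‿distribˡ-*; x∙y⁻¹≈ε⇒x≈y)

units : Field c ℓ → AbelianGroup (c ⊔ ℓ) ℓ
units F = record
  { Carrier = ∃ λ x → ¬ x ≈ 0#
  ; _≈_     = λ x y → proj₁ x ≈ proj₁ y
  ; _∙_     = λ (x , x≉0) (y , y≉0) → x * y , *-nonzero x≉0 y≉0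
  ; ε       = 1# , 1≉0
  ; _⁻¹     = λ (x , x≉0) → let (y , inv) = invertible x x≉0 in y , inverse-nonzero inv
  ; isAbelianGroup = record
    { isGroup = record
      { isMonoid = record
        { isSemigroup = record
          { isMagma = record
            { isEquivalence = record { refl = refl ; sym = sym ; trans = trans }
            ; ∙-cong = *-cong
            }
          ; assoc = λ x y z → *-assoc _ _ _
          }
        ; identity = (λ x → *-identityˡ _) , (λ x → *-identityʳ _)
        }
      ; inverse = (λ (x , x≉0) → trans (*-comm _ _) (proj₂ (invertible x x≉0)))
                , (λ (x , x≉0) → proj₂ (invertible x x≉0))
      ; ⁻¹-cong = λ {(x , x≉0)} {(y , y≉0)} x≈y → *-cancelˡ-nonzero x≉0
          (trans (proj₂ (invertible x x≉0))
                 (sym (trans (*-congʳ x≈y) (proj₂ (invertible y y≉0)))))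
      }
    ; comm = λ x y → *-comm _ _
    }
  }
  where open Field F

module Polynomial (F : Field c ℓ) where
  open Field F
  open SetoidReasoning setoid
  open import Algebra.Properties.Semiring.Sum semiring using (sum; sum-cong-≋; *-distribˡ-sum)
  open import Algebra.Properties.CommutativeSemigroup +-commutativeSemigroup
    using (x∙yz≈y∙xz; interchange)
  open import Algebra.Properties.CommutativeSemigroup *-commutativeSemigroup
    using () renaming (x∙yz≈y∙xz to *-x∙yz≈y∙xz)

  -- p i is the coefficient of Xⁱ.
  eval : ∀ {n} → (Fin n → Carrier) → Carrier → Carrier
  eval {zero}  p x = 0#
  eval {suc n} p x = p zero + x * eval (p ∘ suc) x

  eval-sum : ∀ {n} (p : Fin n → Carrier) x → eval p x ≈ sum (λ i → p i * x ^ toℕ i)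
  eval-sum {zero}  p x = refl
  eval-sum {suc n} p x = +-cong (sym (*-identityʳ _)) (begin
    x * eval (p ∘ suc) x                         ≈⟨ *-congˡ (eval-sum (p ∘ suc) x) ⟩
    x * sum (λ i → p (suc i) * x ^ toℕ i)        ≈⟨ *-distribˡ-sum x (λ i → p (suc i) * x ^ toℕ i) ⟩
    sum (λ i → x * (p (suc i) * x ^ toℕ i))      ≈⟨ sum-cong-≋ {n} (λ i → *-x∙yz≈y∙xz x (p (suc i)) (x ^ toℕ i)) ⟩
    sum (λ i → p (suc i) * x ^ suc (toℕ i))      ∎)

  eval-zero : ∀ {n} (p : Fin n → Carrier) x → (∀ i → p i ≈ 0#) → eval p x ≈ 0#
  eval-zero {zero}  p x p≈0 = refl
  eval-zero {suc n} p x p≈0 = begin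
    p zero + x * eval (p ∘ suc) x  ≈⟨ +-cong (p≈0 zero) (*-congˡ (eval-zero (p ∘ suc) x (p≈0 ∘ suc))) ⟩
    0# + x * 0#                    ≈⟨ +-identityˡ _ ⟩
    x * 0#                         ≈⟨ zeroʳ x ⟩
    0#                             ∎

  -- The quotient on dividing p by X - r.
  quot : ∀ {n} → (Fin (suc n) → Carrier) → Carrier → Fin n → Carrier
  quot {suc n} p r zero    = eval (p ∘ suc) r
  quot {suc n} p r (suc i) = quot (p ∘ suc) r i

  division : ∀ {n} (p : Fin (suc n) → Carrier) r x →
             eval p x + r * eval (quot p r) x ≈ x * eval (quot p r) x + eval p r
  division {zero} p r x = begin
    p zero + x * 0# + r * 0#    ≈⟨ +-cong (+-congˡ (trans (zeroʳ x) (sym (zeroʳ r)))) (trans (zeroʳ r) (sym (zeroʳ x))) ⟩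
    p zero + r * 0# + x * 0#    ≈⟨ +-comm _ _ ⟩
    x * 0# + (p zero + r * 0#)  ∎
  division {suc n} p r x = begin
    p₀ + x * P x + r * (P r + x * Q)        ≈⟨ +-congˡ (distribˡ r _ _) ⟩
    p₀ + x * P x + (r * P r + r * (x * Q))  ≈⟨ interchange _ _ _ _ ⟩
    p₀ + r * P r + (x * P x + r * (x * Q))  ≈⟨ +-congˡ (+-congˡ (*-x∙yz≈y∙xz r x Q)) ⟩
    p₀ + r * P r + (x * P x + x * (r * Q))  ≈⟨ +-congˡ (distribˡ x _ _) ⟨
    p₀ + r * P r + x * (P x + r * Q)        ≈⟨ +-congˡ (*-congˡ (division (p ∘ suc) r x)) ⟩
    p₀ + r * P r + x * (x * Q + P r)        ≈⟨ +-comm _ _ ⟩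
    x * (x * Q + P r) + (p₀ + r * P r)      ≈⟨ +-congʳ (*-congˡ (+-comm _ _)) ⟩
    x * (P r + x * Q) + (p₀ + r * P r)      ∎
    where
    p₀ = p zero
    P = eval (p ∘ suc)
    Q = eval (quot (p ∘ suc) r) x

  quot-zero : ∀ {n} (p : Fin (suc n) → Carrier) r →
              (∀ i → quot p r i ≈ 0#) → eval p r ≈ 0# → ∀ i → p i ≈ 0#
  quot-zero {n} p r q≈0 pr≈0 zero = begin
    p zero                         ≈⟨ +-identityʳ _ ⟨
    p zero + 0#                    ≈⟨ +-congˡ (zeroʳ r) ⟨
    p zero + r * 0#                ≈⟨ +-congˡ (*-congˡ (tail≈0 n p q≈0)) ⟨
    p zero + r * eval (p ∘ suc) r  ≈⟨ pr≈0 ⟩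
    0#                             ∎
    where
    tail≈0 : ∀ n (p : Fin (suc n) → Carrier) → (∀ i → quot p r i ≈ 0#) → eval (p ∘ suc) r ≈ 0#
    tail≈0 zero    p q≈0 = refl
    tail≈0 (suc n) p q≈0 = q≈0 zero
  quot-zero {suc n} p r q≈0 pr≈0 (suc i) = quot-zero (p ∘ suc) r (q≈0 ∘ suc) (q≈0 zero) i

  vanishing : ∀ {n} (p r : Fin n → Carrier) → Injective _≡_ _≈_ r →
              (∀ i → eval p (r i) ≈ 0#) → ∀ i → p i ≈ 0#
  vanishing {suc n} p r r-inj roots =
    quot-zero p r₀ (vanishing (quot p r₀) (r ∘ suc) (Fin.suc-injective ∘ r-inj) quot-root) (roots zero)
    where
    r₀ = r zero
    quot-root : ∀ i → eval (quot p r₀) (r (suc i)) ≈ 0#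
    quot-root i = *-cancel-nonzero (λ eq → Fin.0≢1+n (r-inj eq)) (begin
      r₀ * eval (quot p r₀) x             ≈⟨ +-identityˡ _ ⟨
      0# + r₀ * eval (quot p r₀) x        ≈⟨ +-congʳ (roots (suc i)) ⟨
      eval p x + r₀ * eval (quot p r₀) x  ≈⟨ division p r₀ x ⟩
      x * eval (quot p r₀) x + eval p r₀  ≈⟨ +-congˡ (roots zero) ⟩
      x * eval (quot p r₀) x + 0#         ≈⟨ +-identityʳ _ ⟩
      x * eval (quot p r₀) x              ∎)
      where x = r (suc i)

  monomial : ∀ n → Fin (suc n) → Carrier
  monomial zero    zero    = 1#
  monomial (suc n) zero    = 0#
  monomial (suc n) (suc i) = monomial n i

  eval-monomial : ∀ n x → eval (monomial n) x ≈ x ^ n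
  eval-monomial zero    x = trans (+-congˡ (zeroʳ x)) (+-identityʳ 1#)
  eval-monomial (suc n) x = trans (+-identityˡ _) (*-congˡ (eval-monomial n x))

  monomial-top : ∀ n → monomial n (Fin.fromℕ n) ≈ 1#
  monomial-top zero    = refl
  monomial-top (suc n) = monomial-top n

  unity-roots : ∀ {N M} → 0 ℕ.< N → (r : Fin M → Carrier) → Injective _≡_ _≈_ r →
                (∀ i → r i ^ N ≈ 1#) → M ℕ.≤ N
  unity-roots {suc N} {M} _ r r-inj roots = ℕ.≮⇒≥ λ N<M →
    let r′ = λ i → r (Fin.inject≤ i N<M) in
    1≉0 (trans (sym (monomial-top N))
               (vanishing p r′ (λ eq → Fin.inject≤-injective N<M N<M _ _ (r-inj eq))
                 (λ i → root (r′ i) (roots _)) (Fin.fromℕ (suc N))))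
    where
    p : Fin (suc (suc N)) → Carrier
    p zero    = - 1#
    p (suc i) = monomial N i
    root : ∀ x → x ^ suc N ≈ 1# → eval p x ≈ 0#
    root x eq = begin
      - 1# + x * eval (monomial N) x  ≈⟨ +-congˡ (*-congˡ (eval-monomial N x)) ⟩
      - 1# + x ^ suc N                ≈⟨ +-congˡ eq ⟩
      - 1# + 1#                       ≈⟨ -‿inverseˡ 1# ⟩
      0#                              ∎

module FiniteField (F : Field c ℓ) {n : ℕ} (fin : Field.setoid F HasCardinality n) where
  open Field F
  open FiniteSetoid setoid fin
  open Polynomial F
  private
    module U = AbelianGroup (units F)
    module U^ = Powers (units F)

  n≥2 : 2 ℕ.≤ n
  n≥2 = Fin.injective⇒≤ {f = λ i → index (pair i)} (λ eq → pair-inj _ _ (index-injective eq))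
    where
    pair : Fin 2 → Carrier
    pair zero       = 1#
    pair (suc zero) = 0#
    pair-inj : ∀ i j → pair i ≈ pair j → i ≡ j
    pair-inj zero       zero       _  = ≡.refl
    pair-inj zero       (suc zero) eq = ⊥-elim (1≉0 eq)
    pair-inj (suc zero) zero       eq = ⊥-elim (1≉0 (sym eq))
    pair-inj (suc zero) (suc zero) _  = ≡.refl

  n-1>0 : 0 ℕ.< n ℕ.∸ 1
  n-1>0 = ℕ.m<n⇒0<n∸m n≥2

  1+[n-1]≡n : suc (n ℕ.∸ 1) ≡ n
  1+[n-1]≡n = ℕ.m+[n∸m]≡n (ℕ.≤-trans (s≤s z≤n) n≥2)

  units-finite : U.setoid HasCardinality (n ℕ.∸ 1)
  units-finite = lemma n fin
    where
    lemma : ∀ n → setoid HasCardinality n → U.setoid HasCardinality (n ℕ.∸ 1)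
    lemma zero    fin with () ← Inverse.from fin 0#
    lemma (suc m) fin = record
      { to        = λ i → E.enum (punchIn i₀ i) , λ eq →
                      Fin.punchInᵢ≢i i₀ i (≡.trans (≡.sym (E.index-enum _)) (E.index-cong eq))
      ; from      = λ (x , x≉0) → punchOut (i₀≢ x≉0)
      ; to-cong   = λ { ≡.refl → refl }
      ; from-cong = λ eq → Fin.punchOut-cong i₀ (E.index-cong eq)
      ; inverse   =
          (λ { {x , x≉0} ≡.refl → trans (reflexive (≡.cong E.enum (Fin.punchIn-punchOut (i₀≢ x≉0))))
                                        (E.enum-index x) })
        , (λ {i} {x} eq → ≡.trans (Fin.punchOut-cong i₀ (≡.trans (E.index-cong eq) (E.index-enum _)))
                                  (Fin.punchOut-punchIn i₀))
      }
      where
      module E = FiniteSetoid setoid fin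
      i₀ = E.index 0#
      i₀≢ : ∀ {x} → ¬ x ≈ 0# → ¬ i₀ ≡ E.index x
      i₀≢ x≉0 eq = x≉0 (sym (E.index-injective eq))

  module Ufin = FiniteSetoid U.setoid units-finite

  unit-^ : ∀ (u : U.Carrier) m → proj₁ (u U^.^ m) ≡ proj₁ u ^ m
  unit-^ u zero    = ≡.refl
  unit-^ u (suc m) = ≡.cong (proj₁ u *_) (unit-^ u m)

  units-lagrange : ∀ u → u U^.^ (n ℕ.∸ 1) U.≈ U.ε
  units-lagrange = FiniteAbelianGroup.lagrange (units F) units-finite

  unit-unity-roots : ∀ {m M} → 0 ℕ.< m → (r : Fin M → U.Carrier) → Injective _≡_ U._≈_ r →
                     (∀ i → r i U^.^ m U.≈ U.ε) → M ℕ.≤ m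
  unit-unity-roots {m} 0<m r r-inj roots =
    unity-roots {m} 0<m (proj₁ ∘ r) r-inj
      (λ i → trans (reflexive (≡.sym (unit-^ (r i) m))) (roots i))

  0^n : ∀ {m} → 0 ℕ.< m → 0# ^ m ≈ 0#
  0^n {suc m} _ = zeroˡ _

  fermat : ∀ x → x ^ n ≈ x
  fermat x with x ≟ 0#
  ... | yes x≈0 = trans (^-congˡ n x≈0)
                        (trans (0^n (ℕ.≤-trans (s≤s z≤n) n≥2)) (sym x≈0))
  ... | no x≉0 = begin
    x ^ n              ≡⟨ ≡.cong (x ^_) 1+[n-1]≡n ⟨
    x * x ^ (n ℕ.∸ 1)  ≡⟨ ≡.cong (x *_) (unit-^ (x , x≉0) (n ℕ.∸ 1)) ⟨
    x * proj₁ ((x , x≉0) U^.^ (n ℕ.∸ 1))  ≈⟨ *-congˡ (units-lagrange (x , x≉0)) ⟩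
    x * 1#             ≈⟨ *-identityʳ x ⟩
    x                  ∎
    where open SetoidReasoning setoid

prime-divisor : ∀ n → 1 ℕ.< n → ∃ λ l → Prime l × l ∣ n
prime-divisor n 1<n = lemma (factorise n {{ℕ.>-nonZero (ℕ.<-trans (s≤s z≤n) 1<n)}})
  where
  lemma : PrimeFactorisation n → ∃ λ l → Prime l × l ∣ n
  lemma record { factors = []    ; isFactorisation = ≡.refl } = ⊥-elim (ℕ.<-irrefl ≡.refl 1<n)
  lemma record { factors = l ∷ ls ; isFactorisation = ≡.refl ; factorsPrime = l-prime ∷ _ } =
    l , l-prime , m∣m*n _

prime⇒1< : ∀ {l} → Prime l → 1 ℕ.< l
prime⇒1< {l} l-prime = ℕ.nonTrivial⇒n>1 l {{prime⇒nonTrivial l-prime}}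

prime∤⇒coprime : ∀ {l u} → Prime l → ¬ l ∣ u → Coprime l u
prime∤⇒coprime l-prime l∤u (d∣l , d∣u) with prime⇒irreducible l-prime d∣l
... | inj₁ d≡1 = d≡1
... | inj₂ ≡.refl = ⊥-elim (l∤u d∣u)

prime-power∤⇒coprime : ∀ {l u} a → Prime l → ¬ l ∣ u → Coprime (l ℕ.^ a) u
prime-power∤⇒coprime zero    l-prime l∤u (d∣1 , _) = ∣1⇒≡1 d∣1
prime-power∤⇒coprime (suc a) l-prime l∤u (d∣lᵃ⁺¹ , d∣u) =
  prime-power∤⇒coprime a l-prime l∤u
    (coprime-divisor (λ (c∣d , c∣l) → prime∤⇒coprime l-prime l∤u (c∣l , ∣-trans c∣d d∣u)) d∣lᵃ⁺¹ , d∣u)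

^-mono-∣ : ∀ l {a b} → a ℕ.≤ b → l ℕ.^ a ∣ l ℕ.^ b
^-mono-∣ l {a} {b} a≤b = ≡.subst (l ℕ.^ a ∣_)
  (≡.trans (≡.sym (ℕ.^-distribˡ-+-* l a (b ℕ.∸ a))) (≡.cong (l ℕ.^_) (ℕ.m+[n∸m]≡n a≤b)))
  (m∣m*n (l ℕ.^ (b ℕ.∸ a)))

split-power : ∀ l → 1 ℕ.< l → ∀ n → 0 ℕ.< n → ∃ λ a → ∃ λ u → n ≡ u ℕ.* l ℕ.^ a × ¬ l ∣ u
split-power l 1<l = <-rec _ step
  where
  step : ∀ n → (∀ {m} → m ℕ.< n → 0 ℕ.< m → ∃ λ a → ∃ λ u → m ≡ u ℕ.* l ℕ.^ a × ¬ l ∣ u) →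
         0 ℕ.< n → ∃ λ a → ∃ λ u → n ≡ u ℕ.* l ℕ.^ a × ¬ l ∣ u
  step n rec 0<n with l ∣? n
  ... | no l∤n = 0 , n , ≡.sym (ℕ.*-identityʳ n) , l∤n
  ... | yes (divides zero ≡.refl) = ⊥-elim (ℕ.<-irrefl ≡.refl 0<n)
  ... | yes (divides m@(suc _) ≡.refl)
    with a , u , eq , l∤u ← rec (ℕ.m<m*n m l 1<l) (s≤s z≤n)
    = suc a , u , ≡.trans (≡.cong (ℕ._* l) eq)
                    (≡.trans (ℕ.*-assoc u (l ℕ.^ a) l) (≡.cong (u ℕ.*_) (ℕ.*-comm (l ℕ.^ a) l))) , l∤u

coprime-*-∣ : ∀ {m n j} → Coprime m n → m ∣ j → n ∣ j → m ℕ.* n ∣ j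
coprime-*-∣ {m} {n} cop (divides t ≡.refl) n∣tm =
  ≡.subst (m ℕ.* n ∣_) (ℕ.*-comm m t)
    (*-monoʳ-∣ m (coprime-divisor (coprime-sym cop) (≡.subst (n ∣_) (ℕ.*-comm t m) n∣tm)))

module Order (A : AbelianGroup c ℓ) where
  open AbelianGroup A
  open Powers A
  open SetoidReasoning setoid

  HasOrder : Carrier → ℕ → Set ℓ
  HasOrder x n = x ^ n ≈ ε × (∀ j → x ^ j ≈ ε → n ∣ j)

  order-* : ∀ {x y m n} → Coprime m n → HasOrder x m → HasOrder y n → HasOrder (x ∙ y) (m ℕ.* n)
  order-* {x} {y} {m} {n} cop (xm , x-min) (yn , y-min) = pow , min
    where
    pow : (x ∙ y) ^ (m ℕ.* n) ≈ ε
    pow = begin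
      (x ∙ y) ^ (m ℕ.* n)            ≈⟨ ^-∙ x y (m ℕ.* n) ⟩
      x ^ (m ℕ.* n) ∙ y ^ (m ℕ.* n)  ≈⟨ ∙-cong (^-∣ x (m∣m*n {m} n) xm) (^-∣ y (n∣m*n m) yn) ⟩
      ε ∙ ε                          ≈⟨ identityˡ ε ⟩
      ε                              ∎
    cancel : ∀ j r → (x ∙ y) ^ j ≈ ε → x ^ (j ℕ.* r) ∙ y ^ (j ℕ.* r) ≈ ε
    cancel j r eq = begin
      x ^ (j ℕ.* r) ∙ y ^ (j ℕ.* r)  ≈⟨ ^-∙ x y (j ℕ.* r) ⟨
      (x ∙ y) ^ (j ℕ.* r)            ≈⟨ ^-∣ (x ∙ y) (m∣m*n {j} r) eq ⟩
      ε                              ∎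
    min : ∀ j → (x ∙ y) ^ j ≈ ε → m ℕ.* n ∣ j
    min j eq = coprime-*-∣ cop
      (coprime-divisor cop (≡.subst (m ∣_) (ℕ.*-comm j n) (x-min (j ℕ.* n) (begin
        x ^ (j ℕ.* n)                  ≈⟨ identityʳ _ ⟨
        x ^ (j ℕ.* n) ∙ ε              ≈⟨ ∙-congˡ (^-∣ y (n∣m*n j) yn) ⟨
        x ^ (j ℕ.* n) ∙ y ^ (j ℕ.* n)  ≈⟨ cancel j n eq ⟩
        ε                              ∎))))
      (coprime-divisor (coprime-sym cop) (≡.subst (n ∣_) (ℕ.*-comm j m) (y-min (j ℕ.* m) (begin
        y ^ (j ℕ.* m)                  ≈⟨ identityˡ _ ⟨
        ε ∙ y ^ (j ℕ.* m)              ≈⟨ ∙-congʳ (^-∣ x (n∣m*n j) xm) ⟨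
        x ^ (j ℕ.* m) ∙ y ^ (j ℕ.* m)  ≈⟨ cancel j m eq ⟩
        ε                              ∎))))

  order-prime-power : ∀ {y l} a → Prime l → ¬ y ^ (l ℕ.^ a) ≈ ε → y ^ (l ℕ.^ suc a) ≈ ε →
                      HasOrder y (l ℕ.^ suc a)
  order-prime-power {y} {l} a l-prime yla≉ε ylsa = ylsa , min
    where
    min : ∀ j → y ^ j ≈ ε → l ℕ.^ suc a ∣ j
    min zero      _  = _ ∣0
    min j@(suc _) eq with split-power l (prime⇒1< l-prime) j (s≤s z≤n)
    ... | b , v , j≡vlᵇ , l∤v with suc a ℕ.≤? b
    ...   | yes a<b = ≡.subst (l ℕ.^ suc a ∣_) (≡.sym j≡vlᵇ) (∣-trans (^-mono-∣ l a<b) (n∣m*n v))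
    ...   | no a≮b = ⊥-elim (yla≉ε (^-coprime (y ^ (l ℕ.^ a)) (prime∤⇒coprime l-prime l∤v) w^l w^v))
      where
      b≤a : b ℕ.≤ a
      b≤a = ℕ.s≤s⁻¹ (ℕ.≰⇒> a≮b)
      w^l : (y ^ (l ℕ.^ a)) ^ l ≈ ε
      w^l = trans (^-* y (l ℕ.^ a) l) (trans (^-reflexive y (ℕ.*-comm (l ℕ.^ a) l)) ylsa)
      w^v : (y ^ (l ℕ.^ a)) ^ v ≈ ε
      w^v = trans (^-* y (l ℕ.^ a) v)
              (^-∣ y (≡.subst₂ _∣_ (≡.sym j≡vlᵇ) (ℕ.*-comm v (l ℕ.^ a)) (*-monoʳ-∣ v (^-mono-∣ l b≤a))) eq)

module CyclicCriterion
  (A : AbelianGroup c ℓ) {N : ℕ} (fin : AbelianGroup.setoid A HasCardinality N) (N>0 : 0 ℕ.< N)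
  (root-bound : ∀ {m M} → 0 ℕ.< m → (r : Fin M → AbelianGroup.Carrier A) →
                Injective _≡_ (AbelianGroup._≈_ A) r →
                (∀ i → AbelianGroup._≈_ A (Powers._^_ A (r i) m) (AbelianGroup.ε A)) → M ℕ.≤ m)
  where
  open AbelianGroup A
  open Powers A
  open Order A
  open FiniteSetoid setoid fin
  open FiniteAbelianGroup A fin using (lagrange)

  non-root : ∀ M → 0 ℕ.< M → M ℕ.< N → ∃ λ x → ¬ x ^ M ≈ ε
  non-root M 0<M M<N with search {P = λ x → ¬ x ^ M ≈ ε} (λ x≈y ¬p q → ¬p (trans (^-cong M x≈y) q))
                                      (λ x → ¬? (x ^ M ≟ ε))
  ... | yes found = found
  ... | no none = ⊥-elim (ℕ.<⇒≱ M<N (root-bound 0<M enum enum-injective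
          (λ i → decidable-stable (enum i ^ M ≟ ε) (λ ¬p → none (enum i , ¬p)))))

  prime-power-order : ∀ {l} a → Prime l → l ℕ.^ suc a ∣ N → ∃ λ y → HasOrder y (l ℕ.^ suc a)
  prime-power-order {l} a l-prime (divides zero eq) = ⊥-elim (ℕ.<-irrefl (≡.sym eq) N>0)
  prime-power-order {l} a l-prime (divides t@(suc _) eq) =
    let (x , x^M≉ε) = non-root M 0<M M<N in
    x ^ t , order-prime-power a l-prime (λ p → x^M≉ε (trans (sym (^-* x t (l ℕ.^ a))) p))
      (trans (^-* x t (l ℕ.^ suc a)) (trans (^-reflexive x (≡.sym eq)) (lagrange x)))
    where
    M = t ℕ.* l ℕ.^ a
    0<M : 0 ℕ.< M
    0<M = ℕ.*-mono-≤ {1} {t} {1} {l ℕ.^ a} (s≤s z≤n)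
            (ℕ.m^n>0 l {{ℕ.>-nonZero (ℕ.<-trans (s≤s z≤n) (prime⇒1< l-prime))}} a)
    N≡Ml : N ≡ M ℕ.* l
    N≡Ml = ≡.trans eq (≡.trans (≡.cong (t ℕ.*_) (ℕ.*-comm l (l ℕ.^ a))) (≡.sym (ℕ.*-assoc t (l ℕ.^ a) l)))
    M<N : M ℕ.< N
    M<N = ≡.subst (M ℕ.<_) (≡.sym N≡Ml) (ℕ.m<m*n M l {{ℕ.>-nonZero 0<M}} (prime⇒1< l-prime))

  has-order : ∀ D → 0 ℕ.< D → D ∣ N → ∃ λ g → HasOrder g D
  has-order = <-rec _ step
    where
    step : ∀ D → (∀ {E} → E ℕ.< D → 0 ℕ.< E → E ∣ N → ∃ λ g → HasOrder g E) →
           0 ℕ.< D → D ∣ N → ∃ λ g → HasOrder g D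
    step D rec 0<D D∣N with 1 ℕ.<? D
    ... | no 1≮D = ε , ε^ D , λ j _ → ≡.subst (_∣ j) (ℕ.≤-antisym 0<D (ℕ.≮⇒≥ 1≮D)) (1∣ j)
    ... | yes 1<D with l , l-prime , l∣D ← prime-divisor D 1<D
      with split-power l (prime⇒1< l-prime) D 0<D
    ...   | zero , u , D≡u , l∤u =
            ⊥-elim (l∤u (≡.subst (l ∣_) (≡.trans D≡u (ℕ.*-identityʳ u)) l∣D))
    ...   | suc a , zero , D≡u , l∤u = ⊥-elim (l∤u (l ∣0))
    ...   | suc a , u@(suc _) , ≡.refl , l∤u =
      let (g , g-order) = rec {u} (ℕ.m<m*n u (l ℕ.^ suc a) 1<lᵃ⁺¹) (s≤s z≤n) (∣-trans (m∣m*n _) D∣N)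
          (y , y-order) = prime-power-order a l-prime (∣-trans (n∣m*n u) D∣N)
      in g ∙ y , order-* (coprime-sym (prime-power∤⇒coprime (suc a) l-prime l∤u)) g-order y-order
      where
      1<l = prime⇒1< l-prime
      1<lᵃ⁺¹ : 1 ℕ.< l ℕ.^ suc a
      1<lᵃ⁺¹ = ℕ.≤-trans 1<l (ℕ.m≤m*n l (l ℕ.^ a)
                 {{ℕ.>-nonZero (ℕ.m^n>0 l {{ℕ.>-nonZero (ℕ.<-trans (s≤s z≤n) 1<l)}} a)}})

  generator : ∃ λ g → HasOrder g N
  generator = has-order N N>0 ∣-refl

  cyclic : ∃ λ g → HasOrder g N × ∀ x → ∃ λ i → x ≈ g ^ i
  cyclic with g , g-order@(_ , g-min) ← generator = g , g-order , λ x →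
    let (i , eq) = Fin-injective⇒surjective (λ i → index (g ^ toℕ i))
                     (λ {i} {j} eq → inj g g-min i j (index-injective eq)) (index x)
    in toℕ i , sym (index-injective eq)
    where
    open import Algebra.Properties.Group group using (∙-cancelˡ)
    open SetoidReasoning setoid
    kernel : ∀ g (i j : Fin N) → toℕ i ℕ.≤ toℕ j → g ^ toℕ i ≈ g ^ toℕ j → g ^ (toℕ j ℕ.∸ toℕ i) ≈ ε
    kernel g i j i≤j eq = sym (∙-cancelˡ (g ^ toℕ i) _ _ (begin
      g ^ toℕ i ∙ ε                        ≈⟨ identityʳ _ ⟩
      g ^ toℕ i                            ≈⟨ eq ⟩
      g ^ toℕ j                            ≈⟨ ^-reflexive g (ℕ.m+[n∸m]≡n i≤j) ⟨
      g ^ (toℕ i ℕ.+ (toℕ j ℕ.∸ toℕ i))    ≈⟨ ^-+ g (toℕ i) _ ⟩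
      g ^ toℕ i ∙ g ^ (toℕ j ℕ.∸ toℕ i)    ∎))
    diff : ∀ g → (∀ k → g ^ k ≈ ε → N ∣ k) → ∀ (i j : Fin N) → toℕ i ℕ.≤ toℕ j →
           g ^ toℕ i ≈ g ^ toℕ j → i ≡ j
    diff g g-min i j i≤j eq with toℕ j ℕ.∸ toℕ i in d≡ | g-min (toℕ j ℕ.∸ toℕ i) (kernel g i j i≤j eq)
    ... | zero  | _ = Fin.toℕ-injective (ℕ.≤-antisym i≤j (ℕ.m∸n≡0⇒m≤n d≡))
    ... | suc d | N∣d = ⊥-elim (ℕ.<⇒≱ (Fin.toℕ<n j)
            (ℕ.≤-trans (∣⇒≤ N∣d) (≡.subst (ℕ._≤ toℕ j) d≡ (ℕ.m∸n≤m (toℕ j) (toℕ i)))))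
    inj : ∀ g → (∀ k → g ^ k ≈ ε → N ∣ k) → ∀ i j → g ^ toℕ i ≈ g ^ toℕ j → i ≡ j
    inj g g-min i j eq with ℕ.≤-total (toℕ i) (toℕ j)
    ... | inj₁ i≤j = diff g g-min i j i≤j eq
    ... | inj₂ j≤i = ≡.sym (diff g g-min j i j≤i (sym eq))

mkIsGroupIsomorphism :
  (A : AbelianGroup a ℓ₁) (B : AbelianGroup b ℓ₂) (let module A = AbelianGroup A) (let module B = AbelianGroup B)
  (h : A.Carrier → B.Carrier) → Congruent A._≈_ B._≈_ h → (∀ x y → h (x A.∙ y) B.≈ h x B.∙ h y) →
  Injective A._≈_ B._≈_ h → (∀ y → ∃ λ x → h x B.≈ y) →
  IsGroupIsomorphism A.rawGroup B.rawGroup h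
mkIsGroupIsomorphism A B h h-cong h-homo h-inj h-surj = record
  { isGroupMonomorphism = record
    { isGroupHomomorphism = record
      { isMonoidHomomorphism = record
        { isMagmaHomomorphism = record
          { isRelHomomorphism = record { cong = h-cong }
          ; homo = h-homo
          }
        ; ε-homo = h-ε
        }
      ; ⁻¹-homo = λ x → inverseˡ-unique _ _
          (B.trans (B.sym (h-homo _ _)) (B.trans (h-cong (A.inverseˡ x)) h-ε))
      }
    ; injective = h-inj
    }
  ; surjective = λ y → proj₁ (h-surj y) , λ z≈x → B.trans (h-cong z≈x) (proj₂ (h-surj y))
  }
  where
  module A = AbelianGroup A
  module B = AbelianGroup B
  open import Algebra.Properties.Group B.group using (inverseˡ-unique; identityˡ-unique)
  h-ε : h A.ε B.≈ B.ε
  h-ε = identityˡ-unique (h A.ε) (h A.ε)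
          (B.trans (B.sym (h-homo A.ε A.ε)) (h-cong (A.identityˡ A.ε)))

record GroupIsomorphism (A : AbelianGroup a ℓ₁) (B : AbelianGroup b ℓ₂) : Set (a ⊔ b ⊔ ℓ₁ ⊔ ℓ₂) where
  field
    ⟦_⟧                : AbelianGroup.Carrier A → AbelianGroup.Carrier B
    isGroupIsomorphism : IsGroupIsomorphism (AbelianGroup.rawGroup A) (AbelianGroup.rawGroup B) ⟦_⟧
  open IsGroupIsomorphism isGroupIsomorphism public

Torsion : AbelianGroup c ℓ → ℕ → AbelianGroup (c ⊔ ℓ) ℓ
Torsion A n = record
  { Carrier = ∃ λ x → x ^ n ≈ ε
  ; _≈_     = λ x y → proj₁ x ≈ proj₁ y
  ; _∙_     = λ (x , xⁿ) (y , yⁿ) →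
                x ∙ y , trans (^-∙ x y n) (trans (∙-cong xⁿ yⁿ) (identityˡ ε))
  ; ε       = ε , ε^ n
  ; _⁻¹     = λ (x , xⁿ) → x ⁻¹ , trans (^-⁻¹ x n) (trans (⁻¹-cong xⁿ) ε⁻¹≈ε)
  ; isAbelianGroup = record
    { isGroup = record
      { isMonoid = record
        { isSemigroup = record
          { isMagma = record
            { isEquivalence = record { refl = refl ; sym = sym ; trans = trans }
            ; ∙-cong = ∙-cong
            }
          ; assoc = λ x y z → assoc _ _ _
          }
        ; identity = (λ x → identityˡ _) , (λ x → identityʳ _)
        }
      ; inverse = (λ x → inverseˡ _) , (λ x → inverseʳ _)
      ; ⁻¹-cong = ⁻¹-cong
      }
    ; comm = λ x y → comm _ _
    }
  }
  where
  open AbelianGroup A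
  open Powers A
  open import Algebra.Properties.Group group using (ε⁻¹≈ε)

Quotient : AbelianGroup c ℓ → ℕ → AbelianGroup c (c ⊔ ℓ)
Quotient A n = record
  { Carrier = Carrier
  ; _≈_     = λ x y → ∃ λ z → x ≈ y ∙ z ^ n
  ; _∙_     = _∙_
  ; ε       = ε
  ; _⁻¹     = _⁻¹
  ; isAbelianGroup = record
    { isGroup = record
      { isMonoid = record
        { isSemigroup = record
          { isMagma = record
            { isEquivalence = record { refl = reflQ refl ; sym = symQ ; trans = transQ }
            ; ∙-cong = congQ
            }
          ; assoc = λ x y z → reflQ (assoc x y z)
          }
        ; identity = (λ x → reflQ (identityˡ x)) , (λ x → reflQ (identityʳ x))
        }
      ; inverse = (λ x → reflQ (inverseˡ x)) , (λ x → reflQ (inverseʳ x))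
      ; ⁻¹-cong = invQ
      }
    ; comm = λ x y → reflQ (comm x y)
    }
  }
  where
  open AbelianGroup A
  open Powers A
  open SetoidReasoning setoid
  open import Algebra.Properties.CommutativeSemigroup commutativeSemigroup using (interchange)
  open import Algebra.Properties.AbelianGroup A using (⁻¹-∙-comm)
  _~_ : Carrier → Carrier → Set _
  x ~ y = ∃ λ z → x ≈ y ∙ z ^ n
  reflQ : ∀ {x y} → x ≈ y → x ~ y
  reflQ {x} {y} x≈y = ε , trans x≈y (sym (trans (∙-congˡ (ε^ n)) (identityʳ y)))
  symQ : ∀ {x y} → x ~ y → y ~ x
  symQ {x} {y} (z , eq) = z ⁻¹ , (begin
    y                           ≈⟨ identityʳ y ⟨
    y ∙ ε                       ≈⟨ ∙-congˡ (inverseʳ (z ^ n)) ⟨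
    y ∙ (z ^ n ∙ (z ^ n) ⁻¹)    ≈⟨ assoc _ _ _ ⟨
    y ∙ z ^ n ∙ (z ^ n) ⁻¹      ≈⟨ ∙-cong eq (^-⁻¹ z n) ⟨
    x ∙ (z ⁻¹) ^ n              ∎)
  transQ : ∀ {x y w} → x ~ y → y ~ w → x ~ w
  transQ {x} {y} {w} (z , eq) (z′ , eq′) = z′ ∙ z , (begin
    x                      ≈⟨ eq ⟩
    y ∙ z ^ n              ≈⟨ ∙-congʳ eq′ ⟩
    w ∙ z′ ^ n ∙ z ^ n     ≈⟨ assoc _ _ _ ⟩
    w ∙ (z′ ^ n ∙ z ^ n)   ≈⟨ ∙-congˡ (^-∙ z′ z n) ⟨
    w ∙ (z′ ∙ z) ^ n       ∎)
  congQ : ∀ {x y u v} → x ~ y → u ~ v → (x ∙ u) ~ (y ∙ v)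
  congQ {x} {y} {u} {v} (z , eq) (z′ , eq′) = z ∙ z′ , (begin
    x ∙ u                          ≈⟨ ∙-cong eq eq′ ⟩
    y ∙ z ^ n ∙ (v ∙ z′ ^ n)       ≈⟨ interchange _ _ _ _ ⟩
    y ∙ v ∙ (z ^ n ∙ z′ ^ n)       ≈⟨ ∙-congˡ (^-∙ z z′ n) ⟨
    y ∙ v ∙ (z ∙ z′) ^ n           ∎)
  invQ : ∀ {x y} → x ~ y → (x ⁻¹) ~ (y ⁻¹)
  invQ {x} {y} (z , eq) = z ⁻¹ , (begin
    x ⁻¹                  ≈⟨ ⁻¹-cong eq ⟩
    (y ∙ z ^ n) ⁻¹        ≈⟨ ⁻¹-∙-comm y (z ^ n) ⟨
    y ⁻¹ ∙ (z ^ n) ⁻¹     ≈⟨ ∙-congˡ (^-⁻¹ z n) ⟨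
    y ⁻¹ ∙ (z ⁻¹) ^ n     ∎)

-- The denominator is the image of x ↦ xˢ on all of A, not only on the kernel of x ↦ xᵈ.
Subquotient : AbelianGroup c ℓ → ℕ → ℕ → AbelianGroup (c ⊔ ℓ) (c ⊔ ℓ)
Subquotient A d s = record
  { Carrier = T.Carrier
  ; _≈_     = λ x y → proj₁ x Q.≈ proj₁ y
  ; _∙_     = T._∙_
  ; ε       = T.ε
  ; _⁻¹     = T._⁻¹
  ; isAbelianGroup = record
    { isGroup = record
      { isMonoid = record
        { isSemigroup = record
          { isMagma = record
            { isEquivalence = record { refl = Q.refl ; sym = Q.sym ; trans = Q.trans }
            ; ∙-cong = Q.∙-cong
            }
          ; assoc = λ x y z → Q.assoc (proj₁ x) (proj₁ y) (proj₁ z)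
          }
        ; identity = (λ x → Q.identityˡ (proj₁ x)) , (λ x → Q.identityʳ (proj₁ x))
        }
      ; inverse = (λ x → Q.inverseˡ (proj₁ x)) , (λ x → Q.inverseʳ (proj₁ x))
      ; ⁻¹-cong = Q.⁻¹-cong
      }
    ; comm = λ x y → Q.comm (proj₁ x) (proj₁ y)
    }
  }
  where
  module T = AbelianGroup (Torsion A d)
  module Q = AbelianGroup (Quotient A s)

record GModule (G : Group a ℓ₁) c ℓ : Set (a ⊔ ℓ₁ ⊔ lsuc (c ⊔ ℓ)) where
  infixr 7.5 _·_
  private module G = Group G
  field
    abelianGroup : AbelianGroup c ℓ
  open AbelianGroup abelianGroup public
  open Powers abelianGroup public
  field
    _·_    : G.Carrier → Carrier → Carrier
    ·-cong : ∀ {σ τ x y} → σ G.≈ τ → x ≈ y → σ · x ≈ τ · y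
    ε-·    : ∀ x → G.ε · x ≈ x
    ∙-·    : ∀ σ τ x → (σ G.∙ τ) · x ≈ σ · (τ · x)
    ·-∙    : ∀ σ x y → σ · (x ∙ y) ≈ σ · x ∙ σ · y

  ·-congˡ : ∀ σ {x y} → x ≈ y → σ · x ≈ σ · y
  ·-congˡ σ = ·-cong G.refl

  ·-ε : ∀ σ → σ · ε ≈ ε
  ·-ε σ = identityˡ-unique (σ · ε) (σ · ε) (trans (sym (·-∙ σ ε ε)) (·-congˡ σ (identityˡ ε)))
    where open import Algebra.Properties.Group group using (identityˡ-unique)

  ·-^ : ∀ σ x n → σ · (x ^ n) ≈ (σ · x) ^ n
  ·-^ σ x zero    = ·-ε σ
  ·-^ σ x (suc n) = trans (·-∙ σ x (x ^ n)) (∙-congˡ (·-^ σ x n))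

record GModuleIsomorphism {G : Group a ℓ₁} (C : GModule G b ℓ₂) (D : GModule G c ℓ) :
                          Set (a ⊔ b ⊔ c ⊔ ℓ₁ ⊔ ℓ₂ ⊔ ℓ) where
  private
    module C = GModule C
    module D = GModule D
  field
    ⟦_⟧                : C.Carrier → D.Carrier
    isGroupIsomorphism : IsGroupIsomorphism C.rawGroup D.rawGroup ⟦_⟧
    equivariant        : ∀ σ x → ⟦ σ C.· x ⟧ D.≈ σ D.· ⟦ x ⟧
  open IsGroupIsomorphism isGroupIsomorphism public

  ⟦⟧-^ : ∀ x n → ⟦ x C.^ n ⟧ D.≈ ⟦ x ⟧ D.^ n
  ⟦⟧-^ x zero    = ε-homo
  ⟦⟧-^ x (suc n) = D.trans (∙-homo x (x C.^ n)) (D.∙-congˡ (⟦⟧-^ x n))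

module _ {G : Group a ℓ₁} where

  TorsionModule : GModule G c ℓ → ℕ → GModule G (c ⊔ ℓ) ℓ
  TorsionModule C n = record
    { abelianGroup = Torsion abelianGroup n
    ; _·_    = λ σ (x , xⁿ) → σ · x , trans (sym (·-^ σ x n)) (trans (·-congˡ σ xⁿ) (·-ε σ))
    ; ·-cong = ·-cong
    ; ε-·    = λ x → ε-· _
    ; ∙-·    = λ σ τ x → ∙-· σ τ _
    ; ·-∙    = λ σ x y → ·-∙ σ _ _
    }
    where open GModule C

  QuotientModule : GModule G c ℓ → ℕ → GModule G c (c ⊔ ℓ)
  QuotientModule C n = record
    { abelianGroup = Quotient abelianGroup n
    ; _·_    = _·_
    ; ·-cong = λ {σ} {τ} {x} {y} σ≈τ (z , eq) → τ · z ,
                 trans (·-cong σ≈τ eq) (trans (·-∙ τ y (z ^ n)) (∙-congˡ (·-^ τ z n)))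
    ; ε-·    = λ x → Q.reflexive′ (ε-· x)
    ; ∙-·    = λ σ τ x → Q.reflexive′ (∙-· σ τ x)
    ; ·-∙    = λ σ x y → Q.reflexive′ (·-∙ σ x y)
    }
    where
    open GModule C
    module Q where
      reflexive′ : ∀ {x y} → x ≈ y → ∃ λ z → x ≈ y ∙ z ^ n
      reflexive′ {x} {y} x≈y = ε , trans x≈y (sym (trans (∙-congˡ (ε^ n)) (identityʳ y)))

geometric : ℕ → ℕ → ℕ
geometric q f = sumℕ λ (i : Fin f) → q ℕ.^ toℕ i

-- For G cyclic of order f with generator γ.  The hypothesis that γ acts on C
-- as x ↦ x^q is what makes the image of x ↦ x^(1 + q + ⋯ + q^(f-1)) lie in the
-- kernel of x ↦ x^(q-1): see image⊆kernel for G the Galois group.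
module Cohomology {G : Group a ℓ₁} (γ : Group.Carrier G) (q f : ℕ) where

  ActsByPower : GModule G c ℓ → Set (c ⊔ ℓ)
  ActsByPower C = ∀ x → γ · x ≈ x ^ q
    where open GModule C

  H² : (C : GModule G c ℓ) → ActsByPower C → AbelianGroup (c ⊔ ℓ) (c ⊔ ℓ)
  H² C _ = Subquotient (GModule.abelianGroup C) (q ℕ.∸ 1) (geometric q f)

  H²-map : (C : GModule G b ℓ₂) (C-power : ActsByPower C) (D : GModule G c ℓ) (D-power : ActsByPower D) →
           GModuleIsomorphism C D → GroupIsomorphism (H² C C-power) (H² D D-power)
  H²-map C C-power D D-power θ = record
    { ⟦_⟧ = h
    ; isGroupIsomorphism = mkIsGroupIsomorphism (H² C C-power) (H² D D-power) h
        (λ {x} {y} (z , eq) → ⟦ z ⟧ , (begin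
          ⟦ proj₁ x ⟧                   ≈⟨ ⟦⟧-cong eq ⟩
          ⟦ proj₁ y C.∙ z C.^ s ⟧       ≈⟨ ∙-homo (proj₁ y) (z C.^ s) ⟩
          ⟦ proj₁ y ⟧ D.∙ ⟦ z C.^ s ⟧   ≈⟨ D.∙-congˡ (⟦⟧-^ z s) ⟩
          ⟦ proj₁ y ⟧ D.∙ ⟦ z ⟧ D.^ s   ∎))
        (λ (x , _) (y , _) → D.ε , D.trans (∙-homo x y)
          (D.sym (D.trans (D.∙-congˡ (D.ε^ s)) (D.identityʳ _))))
        (λ {x} {y} (w , eq) → let (z , z↦) = surjective w in z , injective (begin
          ⟦ proj₁ x ⟧                   ≈⟨ eq ⟩
          ⟦ proj₁ y ⟧ D.∙ w D.^ s       ≈⟨ D.∙-congˡ (D.^-cong s (z↦ C.refl)) ⟨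
          ⟦ proj₁ y ⟧ D.∙ ⟦ z ⟧ D.^ s   ≈⟨ D.∙-congˡ (⟦⟧-^ z s) ⟨
          ⟦ proj₁ y ⟧ D.∙ ⟦ z C.^ s ⟧   ≈⟨ ∙-homo (proj₁ y) (z C.^ s) ⟨
          ⟦ proj₁ y C.∙ z C.^ s ⟧       ∎))
        (λ (y , yᵈ) → let (x , x↦) = surjective y in
          (x , injective (D.trans (⟦⟧-^ x d) (D.trans (D.^-cong d (x↦ C.refl)) (D.trans yᵈ (D.sym ε-homo))))) ,
          D.ε , D.trans (x↦ C.refl) (D.sym (D.trans (D.∙-congˡ (D.ε^ s)) (D.identityʳ y))))
    }
    where
    module C = GModule C
    module D = GModule D
    open GModuleIsomorphism θ
    open SetoidReasoning D.setoid
    d = q ℕ.∸ 1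
    s = geometric q f
    h : AbelianGroup.Carrier (H² C C-power) → AbelianGroup.Carrier (H² D D-power)
    h (x , xᵈ) = ⟦ x ⟧ , D.trans (D.sym (⟦⟧-^ x d)) (D.trans (⟦⟧-cong xᵈ) ε-homo)

power-isomorphism :
  {G : Group a ℓ₁} (C : GModule G c ℓ) (let open GModule C) (e m : ℕ) .{{_ : NonZero e}} .{{_ : NonZero m}} →
  (g : Carrier) → Order.HasOrder abelianGroup g (e ℕ.* m) → (∀ x → ∃ λ i → x ≈ g ^ i) →
  GModuleIsomorphism (QuotientModule C e) (TorsionModule C e)
power-isomorphism C e m g (gᴺ , g-min) generates = record
  { ⟦_⟧ = h
  ; isGroupIsomorphism = mkIsGroupIsomorphism (Quotient abelianGroup e) (Torsion abelianGroup e) h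
      (λ {x} {y} (z , eq) → begin
        x ^ m                    ≈⟨ ^-cong m eq ⟩
        (y ∙ z ^ e) ^ m          ≈⟨ ^-∙ y (z ^ e) m ⟩
        y ^ m ∙ (z ^ e) ^ m      ≈⟨ ∙-congˡ (trans (^-* z e m) (all-N z)) ⟩
        y ^ m ∙ ε                ≈⟨ identityʳ _ ⟩
        y ^ m                    ∎)
      (λ x y → ^-∙ x y m)
      h-injective
      (λ (x , xᵉ) → e-kernel x xᵉ)
  ; equivariant = λ σ x → sym (·-^ σ x m)
  }
  where
  open GModule C
  open SetoidReasoning setoid
  open import Algebra.Properties.Group group using (//-rightDividesˡ)
  all-N : ∀ x → x ^ (e ℕ.* m) ≈ ε
  all-N x = let (i , x≈gⁱ) = generates x in begin
    x ^ (e ℕ.* m)          ≈⟨ ^-cong (e ℕ.* m) x≈gⁱ ⟩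
    (g ^ i) ^ (e ℕ.* m)    ≈⟨ ^-^-comm g i (e ℕ.* m) ⟩
    (g ^ (e ℕ.* m)) ^ i    ≈⟨ ^-cong i gᴺ ⟩
    ε ^ i                  ≈⟨ ε^ i ⟩
    ε                      ∎
  h : Carrier → ∃ λ x → x ^ e ≈ ε
  h x = x ^ m , trans (^-^-comm x m e) (trans (^-* x e m) (all-N x))
  m-kernel : ∀ x → x ^ m ≈ ε → ∃ λ z → x ≈ z ^ e
  m-kernel x xᵐ with i , x≈gⁱ ← generates x
    with divides t ≡.refl ← *-cancelˡ-∣ m (≡.subst₂ _∣_ (ℕ.*-comm e m) (ℕ.*-comm i m)
           (g-min (i ℕ.* m) (trans (sym (^-* g i m)) (trans (^-cong m (sym x≈gⁱ)) xᵐ))))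
    = g ^ t , trans x≈gⁱ (sym (^-* g t e))
  e-kernel : ∀ x → x ^ e ≈ ε → ∃ λ z → z ^ m ≈ x
  e-kernel x xᵉ with i , x≈gⁱ ← generates x
    with divides t ≡.refl ← *-cancelˡ-∣ e (≡.subst (e ℕ.* m ∣_) (ℕ.*-comm i e)
           (g-min (i ℕ.* e) (trans (sym (^-* g i e)) (trans (^-cong e (sym x≈gⁱ)) xᵉ))))
    = g ^ t , trans (^-* g t m) (sym x≈gⁱ)
  h-injective : ∀ {x y} → x ^ m ≈ y ^ m → ∃ λ z → x ≈ y ∙ z ^ e
  h-injective {x} {y} eq =
    let (z , z-eq) = m-kernel (x ∙ y ⁻¹) quotient-kernel in
    z , trans (sym (//-rightDividesˡ y x)) (trans (comm _ _) (∙-congˡ z-eq))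
    where
    quotient-kernel : (x ∙ y ⁻¹) ^ m ≈ ε
    quotient-kernel = begin
      (x ∙ y ⁻¹) ^ m       ≈⟨ ^-∙ x (y ⁻¹) m ⟩
      x ^ m ∙ (y ⁻¹) ^ m   ≈⟨ ∙-cong eq (^-⁻¹ y m) ⟩
      y ^ m ∙ (y ^ m) ⁻¹   ≈⟨ inverseʳ _ ⟩
      ε                    ∎

record FieldExtension (k : Field c ℓ) (K : Field a ℓ₁) (f : ℕ) : Set (c ⊔ ℓ ⊔ a ⊔ ℓ₁) where
  private
    module k = Field k
    module K = Field K
  field
    ι                  : k.Carrier → K.Carrier
    isRingHomomorphism : IsRingHomomorphism k.rawRing K.rawRing ι
  open IsRingHomomorphism isRingHomomorphism public

  open SemiringSum K.semiring using (sum)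

  combination : (Fin f → K.Carrier) → (Fin f → k.Carrier) → K.Carrier
  combination v c = sum λ i → ι (c i) K.* v i

  field
    basis                : Fin f → K.Carrier
    spanning             : ∀ x → ∃ λ c → combination basis c K.≈ x
    linearly-independent : ∀ c → combination basis c K.≈ K.0# → ∀ i → c i k.≈ k.0#

mkIsRingIsomorphism :
  (R : Field a ℓ₁) (S : Field b ℓ₂) (let module R = Field R) (let module S = Field S)
  (h : R.Carrier → S.Carrier) → Congruent R._≈_ S._≈_ h →
  (∀ x y → h (x R.+ y) S.≈ h x S.+ h y) → (∀ x y → h (x R.* y) S.≈ h x S.* h y) → h R.1# S.≈ S.1# →
  Injective R._≈_ S._≈_ h → (∀ y → ∃ λ x → h x S.≈ y) →
  IsRingIsomorphism R.rawRing S.rawRing h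
mkIsRingIsomorphism R S h h-cong h-+ h-* h-1 h-inj h-surj = record
  { isRingMonomorphism = record
    { isRingHomomorphism = record
      { isSemiringHomomorphism = record
        { isNearSemiringHomomorphism = record
          { +-isMonoidHomomorphism = H.isMonoidHomomorphism
          ; *-homo = h-*
          }
        ; 1#-homo = h-1
        }
      ; -‿homo = H.⁻¹-homo
      }
    ; injective = h-inj
    }
  ; surjective = H.surjective
  }
  where
  module R = Field R
  module S = Field S
  module H = IsGroupIsomorphism (mkIsGroupIsomorphism R.+-abelianGroup S.+-abelianGroup h h-cong h-+ h-inj h-surj)

module GaloisGroup {k : Field c ℓ} {K : Field a ℓ₁} {f : ℕ} (extension : FieldExtension k K f) where
  private
    module k = Field k
  open Field K
  open FieldExtension extension using (ι)

  record Automorphism : Set (c ⊔ a ⊔ ℓ₁) where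
    field
      ⟦_⟧               : Carrier → Carrier
      isRingIsomorphism : IsRingIsomorphism rawRing rawRing ⟦_⟧
      fixes-base        : ∀ x → ⟦ ι x ⟧ ≈ ι x
    open IsRingIsomorphism isRingIsomorphism public

  open Automorphism using (⟦_⟧)

  compose : Automorphism → Automorphism → Automorphism
  compose σ τ = record
    { ⟦_⟧               = ⟦ σ ⟧ ∘ ⟦ τ ⟧
    ; isRingIsomorphism = Compose.isRingIsomorphism trans (Automorphism.isRingIsomorphism τ)
                                                          (Automorphism.isRingIsomorphism σ)
    ; fixes-base        = λ x → trans (Automorphism.⟦⟧-cong σ (Automorphism.fixes-base τ x))
                                      (Automorphism.fixes-base σ x)
    }

  identity : Automorphism
  identity = record
    { ⟦_⟧               = id
    ; isRingIsomorphism = Identity.isRingIsomorphism rawRing refl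
    ; fixes-base        = λ x → refl
    }

  inverse : Automorphism → Automorphism
  inverse σ = record
    { ⟦_⟧               = pre
    ; isRingIsomorphism = mkIsRingIsomorphism K K pre
        (λ x≈y → injective (trans (pre-eq _) (trans x≈y (sym (pre-eq _)))))
        (λ x y → injective (trans (pre-eq _) (sym (trans (+-homo _ _) (+-cong (pre-eq x) (pre-eq y))))))
        (λ x y → injective (trans (pre-eq _) (sym (trans (*-homo _ _) (*-cong (pre-eq x) (pre-eq y))))))
        (injective (trans (pre-eq _) (sym 1#-homo)))
        (λ {x} {y} eq → trans (sym (pre-eq x)) (trans (⟦⟧-cong eq) (pre-eq y)))
        (λ y → ⟦ σ ⟧ y , injective (pre-eq _))
    ; fixes-base        = λ x → injective (trans (pre-eq _) (sym (fixes-base x)))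
    }
    where
    open Automorphism σ hiding (⟦_⟧)
    pre : Carrier → Carrier
    pre y = proj₁ (surjective y)
    pre-eq : ∀ y → ⟦ σ ⟧ (pre y) ≈ y
    pre-eq y = proj₂ (surjective y) refl

  galoisGroup : Group (c ⊔ a ⊔ ℓ₁) (a ⊔ ℓ₁)
  galoisGroup = record
    { Carrier = Automorphism
    ; _≈_     = λ σ τ → ∀ x → ⟦ σ ⟧ x ≈ ⟦ τ ⟧ x
    ; _∙_     = compose
    ; ε       = identity
    ; _⁻¹     = inverse
    ; isGroup = record
      { isMonoid = record
        { isSemigroup = record
          { isMagma = record
            { isEquivalence = record
              { refl  = λ x → refl
              ; sym   = λ eq x → sym (eq x)
              ; trans = λ eq eq′ x → trans (eq x) (eq′ x)
              }
            ; ∙-cong = λ {σ} {σ′} {τ} {τ′} eq eq′ x →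
                trans (eq (⟦ τ ⟧ x)) (Automorphism.⟦⟧-cong σ′ (eq′ x))
            }
          ; assoc = λ σ τ υ x → refl
          }
        ; identity = (λ σ x → refl) , (λ σ x → refl)
        }
      ; inverse = (λ σ x → Automorphism.injective σ (proj₂ (Automorphism.surjective σ (⟦ σ ⟧ x)) refl))
                , (λ σ x → proj₂ (Automorphism.surjective σ x) refl)
      ; ⁻¹-cong = λ {σ} {τ} eq x → Automorphism.injective σ
          (trans (proj₂ (Automorphism.surjective σ x) refl)
                 (sym (trans (eq _) (proj₂ (Automorphism.surjective τ x) refl))))
      }
    }

  unitsModule : GModule galoisGroup (a ⊔ ℓ₁) ℓ₁
  unitsModule = record
    { abelianGroup = units K
    ; _·_    = λ σ (x , x≉0) → ⟦ σ ⟧ x , λ eq → x≉0 (Automorphism.injective σ (trans eq (sym (Automorphism.0#-homo σ))))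
    ; ·-cong = λ {σ} {τ} σ≈τ x≈y → trans (σ≈τ _) (Automorphism.⟦⟧-cong τ x≈y)
    ; ε-·    = λ x → refl
    ; ∙-·    = λ σ τ x → refl
    ; ·-∙    = λ σ x y → Automorphism.*-homo σ _ _
    }

funToFin-cong : ∀ {m n} {g h : Fin m → Fin n} → (∀ i → g i ≡ h i) → Fin.funToFin g ≡ Fin.funToFin h
funToFin-cong {zero}  eq = ≡.refl
funToFin-cong {suc m} eq = ≡.cong₂ Fin.combine (eq zero) (funToFin-cong (eq ∘ suc))

[q-1]*geometric : ∀ q f → 0 ℕ.< q → (q ℕ.∸ 1) ℕ.* geometric q f ≡ q ℕ.^ f ℕ.∸ 1
[q-1]*geometric (suc p) f _ = ≡.cong (ℕ._∸ 1) (lemma f)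
  where
  open MonoidSum ℕ.+-0-commutativeMonoid using (sum; sum-cong-≗)
  q = suc p
  sum-* : ∀ n (t : Fin n → ℕ) → sum (λ i → q ℕ.* t i) ≡ q ℕ.* sum t
  sum-* zero    t = ≡.sym (ℕ.*-zeroʳ q)
  sum-* (suc n) t = ≡.trans (≡.cong (q ℕ.* t zero ℕ.+_) (sum-* n (t ∘ suc)))
                            (≡.sym (ℕ.*-distribˡ-+ q (t zero) (sum (t ∘ suc))))
  lemma : ∀ f → suc (p ℕ.* geometric q f) ≡ q ℕ.^ f
  lemma zero    = ≡.cong suc (ℕ.*-zeroʳ p)
  lemma (suc f) = begin
    suc (p ℕ.* (1 ℕ.+ sum {f} (λ i → q ℕ.* q ℕ.^ toℕ i)))  ≡⟨ ≡.cong (λ t → suc (p ℕ.* (1 ℕ.+ t))) (sum-* f _) ⟩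
    suc (p ℕ.* (1 ℕ.+ q ℕ.* g))                            ≡⟨ ≡.cong suc (ℕ.*-distribˡ-+ p 1 (q ℕ.* g)) ⟩
    suc (p ℕ.* 1 ℕ.+ p ℕ.* (q ℕ.* g))                      ≡⟨ ≡.cong₂ (λ s t → suc (s ℕ.+ t)) (ℕ.*-identityʳ p) swap ⟩
    q ℕ.+ q ℕ.* (p ℕ.* g)                                  ≡⟨ ℕ.*-suc q (p ℕ.* g) ⟨
    q ℕ.* suc (p ℕ.* g)                                    ≡⟨ ≡.cong (q ℕ.*_) (lemma f) ⟩
    q ℕ.* q ℕ.^ f                                          ∎
    where
    open ≡.≡-Reasoning
    g = geometric q f
    swap : p ℕ.* (q ℕ.* g) ≡ q ℕ.* (p ℕ.* g)
    swap = ≡.trans (≡.sym (ℕ.*-assoc p q g)) (≡.trans (≡.cong (ℕ._* g) (ℕ.*-comm p q)) (ℕ.*-assoc q p g))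

module BinomialTerms (F : Field c ℓ) (m : ℕ) where
  open Field F
  open SetoidReasoning setoid
  open SemiringSum semiring using (sum; sum-cong-≋; sum-init-last)
  open SemiringMult semiring using (×-congˡ) renaming (_×_ to _⊗_)

  middle : Carrier → Carrier → Carrier
  middle x y = sum {m} λ i → choose (suc m) (suc (toℕ i)) ⊗ (x ^ suc (toℕ i) * y ^ (m ℕ.∸ toℕ i))

  binomial-theorem : ∀ x y → (x + y) ^ suc m ≈ y ^ suc m + (middle x y + x ^ suc m)
  binomial-theorem x y = begin
    (x + y) ^ suc m                                            ≈⟨ B.theorem (suc m) x y ⟩
    term zero + sum (term ∘ suc)                               ≈⟨ +-cong first (sum-init-last (term ∘ suc)) ⟩
    y ^ suc m + (sum {m} (term ∘ suc ∘ Fin.inject₁) + term (suc (Fin.fromℕ m)))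
                                                               ≈⟨ +-congˡ (+-cong (sum-cong-≋ {m} inner) final) ⟩
    y ^ suc m + (middle x y + x ^ suc m)                       ∎
    where
    module B = Binomial commutativeSemiring
    term : Fin (suc (suc m)) → Carrier
    term = B.binomialTerm x y (suc m)
    termℕ : ℕ → Carrier
    termℕ j = choose (suc m) j ⊗ (x ^ j * y ^ (suc m ℕ.∸ j))
    first : term zero ≈ y ^ suc m
    first = trans (+-identityʳ _) (*-identityˡ _)
    inner : ∀ i → term (suc (Fin.inject₁ i)) ≈ termℕ (suc (toℕ i))
    inner i = reflexive (≡.cong (termℕ ∘ suc) (Fin.toℕ-inject₁ i))
    final : term (suc (Fin.fromℕ m)) ≈ x ^ suc m
    final = begin
      termℕ (suc (toℕ (Fin.fromℕ m)))                  ≡⟨ ≡.cong (termℕ ∘ suc) (Fin.toℕ-fromℕ m) ⟩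
      choose (suc m) (suc m) ⊗ (x ^ suc m * y ^ (m ℕ.∸ m))
        ≡⟨ ≡.cong₂ (λ t u → t ⊗ (x ^ suc m * y ^ u)) (nCn≡1 (suc m)) (ℕ.n∸n≡0 m) ⟩
      1 ⊗ (x ^ suc m * 1#)                             ≈⟨ +-identityʳ _ ⟩
      x ^ suc m * 1#                                   ≈⟨ *-identityʳ _ ⟩
      x ^ suc m                                        ∎

-- Over a field with m + 1 elements, (X + 1)^(m+1) - X^(m+1) - 1 has degree at
-- most m and vanishes everywhere.
binomial-coefficients-vanish :
  (F : Field c ℓ) (let open Field F) {m : ℕ} → setoid HasCardinality suc m →
  ∀ (i : Fin m) → times +-rawMonoid (choose (suc m) (suc (toℕ i))) 1# ≈ 0#
binomial-coefficients-vanish F {m} fin i = vanishing p E.enum E.enum-injective (λ j → root (E.enum j)) (suc i)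
  where
  open Field F
  open SetoidReasoning setoid
  open Polynomial F
  open BinomialTerms F m
  open SemiringSum semiring using (sum-cong-≋)
  open SemiringMult semiring using (×-assoc-*; ×-congʳ) renaming (_×_ to _⊗_)
  open import Algebra.Properties.Ring ring using (+-identityˡ-unique; +-cancelˡ)
  module E = FiniteSetoid setoid fin
  p : Fin (suc m) → Carrier
  p zero    = 0#
  p (suc i) = choose (suc m) (suc (toℕ i)) ⊗ 1#
  1^ : ∀ n → 1# ^ n ≈ 1#
  1^ zero    = refl
  1^ (suc n) = trans (*-identityˡ _) (1^ n)
  eval-middle : ∀ x → eval p x ≈ middle x 1#
  eval-middle x = trans (eval-sum p x) (trans (+-congʳ (zeroˡ _)) (trans (+-identityˡ _)
    (sum-cong-≋ {m} λ i → trans (×-assoc-* (choose (suc m) (suc (toℕ i))) _ _)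
      (×-congʳ (choose (suc m) (suc (toℕ i)))
        (trans (*-comm _ _) (*-congˡ (sym (1^ (m ℕ.∸ toℕ i)))))))))
  middle-zero : ∀ x → middle x 1# ≈ 0#
  middle-zero x = +-identityˡ-unique _ _ (+-cancelˡ 1# _ _ (begin
    1# + (middle x 1# + x)                        ≈⟨ +-cong (1^ (suc m)) (+-congˡ (fermat x)) ⟨
    1# ^ suc m + (middle x 1# + x ^ suc m)        ≈⟨ binomial-theorem x 1# ⟨
    (x + 1#) ^ suc m                              ≈⟨ fermat (x + 1#) ⟩
    x + 1#                                        ≈⟨ +-comm _ _ ⟩
    1# + x                                        ∎))
    where open FiniteField F fin using (fermat)
  root : ∀ x → eval p x ≈ 0#
  root x = trans (eval-middle x) (middle-zero x)

module FiniteFieldExtension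
  {k : Field c ℓ} {K : Field a ℓ₁} {q f : ℕ} (f>0 : 0 ℕ.< f)
  (k-finite : Field.setoid k HasCardinality q)
  (extension : FieldExtension k K f)
  where
  private
    module k = Field k
    module Fk = FiniteField k k-finite
    module Ek = FiniteSetoid k.setoid k-finite
  open Field K
  open FieldExtension extension
  open GaloisGroup extension
  open Automorphism using (⟦_⟧)
  open SetoidReasoning setoid

  open SemiringSum semiring
    using (sum; sum-cong-≋; ∑-distrib-+; *-distribˡ-sum; *-distribʳ-sum; sum-replicate-zero; sum-init-last)
  open import Algebra.Properties.Ring ring using (-‿distribˡ-*; x∙y⁻¹≈ε⇒x≈y; x≈y⇒x∙y⁻¹≈ε)

  combination-cong : ∀ {v v′ c c′} → (∀ i → v i ≈ v′ i) → (∀ i → c i k.≈ c′ i) →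
                     combination v c ≈ combination v′ c′
  combination-cong v≈v′ c≈c′ = sum-cong-≋ {f} (λ i → *-cong (⟦⟧-cong (c≈c′ i)) (v≈v′ i))

  combination-injective : ∀ {c c′} → combination basis c ≈ combination basis c′ → ∀ i → c i k.≈ c′ i
  combination-injective {c} {c′} eq i = k-x∙y⁻¹≈ε⇒x≈y _ _
    (linearly-independent (λ i → c i k.- c′ i) (x+y≈y⇒x≈0 (begin
      combination basis (λ i → c i k.- c′ i) + combination basis c′
        ≈⟨ ∑-distrib-+ {f} _ _ ⟨
      sum (λ i → ι (c i k.- c′ i) * basis i + ι (c′ i) * basis i)
        ≈⟨ sum-cong-≋ {f} (λ i → trans (sym (distribʳ _ _ _)) (*-congʳ (trans (sym (+-homo _ _)) (⟦⟧-cong (k-//-rightDividesˡ _ _))))) ⟩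
      combination basis c
        ≈⟨ eq ⟩
      combination basis c′ ∎)) i)
    where
    open import Algebra.Properties.Ring k.ring using ()
      renaming (x∙y⁻¹≈ε⇒x≈y to k-x∙y⁻¹≈ε⇒x≈y; //-rightDividesˡ to k-//-rightDividesˡ)
    open import Algebra.Properties.Ring ring using (+-identityˡ-unique)
    x+y≈y⇒x≈0 : ∀ {x y} → x + y ≈ y → x ≈ 0#
    x+y≈y⇒x≈0 eq = +-identityˡ-unique _ _ eq

  K-finite : setoid HasCardinality (q ℕ.^ f)
  K-finite = record
    { to        = λ i → combination basis (Ek.enum ∘ Fin.finToFun i)
    ; from      = λ x → Fin.funToFin (Ek.index ∘ proj₁ (spanning x))
    ; to-cong   = λ { ≡.refl → refl }
    ; from-cong = λ {x} {y} eq → funToFin-cong (λ i → Ek.index-cong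
        (combination-injective (trans (proj₂ (spanning x)) (trans eq (sym (proj₂ (spanning y))))) i))
    ; inverse   =
        (λ { {x} ≡.refl → trans (combination-cong (λ i → refl) (λ i →
               k.trans (k.reflexive (≡.cong Ek.enum (Fin.finToFun-funToFin (Ek.index ∘ proj₁ (spanning x)) i)))
                       (Ek.enum-index _)))
             (proj₂ (spanning x)) })
      , (λ {i} {x} eq → ≡.trans
           (funToFin-cong (λ j → ≡.trans
             (Ek.index-cong (combination-injective (trans (proj₂ (spanning x)) eq) j))
             (Ek.index-enum _)))
           (Fin.funToFin-finToFin {f} {q} i))
    }

  module FK = FiniteField K K-finite
  module EK = FiniteSetoid setoid K-finite
  open EK using (_≟_)

  ι-nonzero : ∀ {x} → ¬ x k.≈ k.0# → ¬ ι x ≈ 0#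
  ι-nonzero {x} x≉0 ιx≈0 with y , inv ← k.invertible x x≉0 = 1≉0 (begin
    1#           ≈⟨ 1#-homo ⟨
    ι k.1#       ≈⟨ ⟦⟧-cong inv ⟨
    ι (x k.* y)  ≈⟨ *-homo x y ⟩
    ι x * ι y    ≈⟨ *-congʳ ιx≈0 ⟩
    0# * ι y     ≈⟨ zeroˡ _ ⟩
    0#           ∎)

  ι-^ : ∀ x n → ι (x k.^ n) ≈ ι x ^ n
  ι-^ x zero    = 1#-homo
  ι-^ x (suc n) = trans (*-homo x _) (*-congˡ (ι-^ x n))

  ι-injective : ∀ {x y} → ι x ≈ ι y → x k.≈ y
  ι-injective {x} {y} eq with (x k.- y) Ek.≟ k.0#
  ... | yes d≈0 = k-x∙y⁻¹≈ε⇒x≈y _ _ d≈0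
    where open import Algebra.Properties.Ring k.ring using () renaming (x∙y⁻¹≈ε⇒x≈y to k-x∙y⁻¹≈ε⇒x≈y)
  ... | no d≉0 = ⊥-elim (ι-nonzero d≉0
          (trans (+-homo _ _) (trans (+-congˡ (-‿homo y)) (x≈y⇒x∙y⁻¹≈ε eq))))

  ^q-+ : ∀ x y → (x + y) ^ q ≈ x ^ q + y ^ q
  ^q-+ = lemma q k-finite
    where
    open import Algebra.Properties.Semiring.Mult semiring using (×-assoc-*; ×-congʳ) renaming (_×_ to _⊗_)
    module k⊗ = SemiringMult k.semiring
    ι-⊗ : ∀ n → ι (n k⊗.× k.1#) ≈ n ⊗ 1#
    ι-⊗ zero    = 0#-homo
    ι-⊗ (suc n) = trans (+-homo _ _) (+-cong 1#-homo (ι-⊗ n))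
    lemma : ∀ n → k.setoid HasCardinality n → ∀ x y → (x + y) ^ n ≈ x ^ n + y ^ n
    lemma zero    fin with () ← Inverse.from fin k.0#
    lemma (suc m) fin x y = begin
      (x + y) ^ suc m                         ≈⟨ binomial-theorem x y ⟩
      y ^ suc m + (middle x y + x ^ suc m)    ≈⟨ +-congˡ (+-congʳ middle-zero) ⟩
      y ^ suc m + (0# + x ^ suc m)            ≈⟨ +-congˡ (+-identityˡ _) ⟩
      y ^ suc m + x ^ suc m                   ≈⟨ +-comm _ _ ⟩
      x ^ suc m + y ^ suc m                   ∎
      where
      open BinomialTerms K m
      coefficient : ∀ i z → choose (suc m) (suc (toℕ i)) ⊗ z ≈ 0#
      coefficient i z = begin
        n ⊗ z                  ≈⟨ ×-congʳ n (*-identityˡ z) ⟨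
        n ⊗ (1# * z)           ≈⟨ ×-assoc-* n 1# z ⟨
        n ⊗ 1# * z             ≈⟨ *-congʳ (ι-⊗ n) ⟨
        ι (n k⊗.× k.1#) * z    ≈⟨ *-congʳ (⟦⟧-cong (binomial-coefficients-vanish k fin i)) ⟩
        ι k.0# * z             ≈⟨ *-congʳ 0#-homo ⟩
        0# * z                 ≈⟨ zeroˡ z ⟩
        0#                     ∎
        where n = choose (suc m) (suc (toℕ i))
      middle-zero : middle x y ≈ 0#
      middle-zero = trans (sum-cong-≋ {m} (λ i → coefficient i _)) (sum-replicate-zero m)

  q>0 : 0 ℕ.< q
  q>0 = ℕ.≤-trans (s≤s z≤n) Fk.n≥2

  open import Algebra.Properties.CommutativeSemiring.Exp commutativeSemiring using (^-distrib-*)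
  open import Algebra.Properties.Semiring.Exp semiring using (^-assocʳ; ^-homo-*)

  ^-nonzero : ∀ {x} n → ¬ x ≈ 0# → ¬ x ^ n ≈ 0#
  ^-nonzero zero    x≉0 = 1≉0
  ^-nonzero (suc n) x≉0 = *-nonzero x≉0 (^-nonzero n x≉0)

  1^ : ∀ n → 1# ^ n ≈ 1#
  1^ zero    = refl
  1^ (suc n) = trans (*-identityˡ _) (1^ n)

  ^q-injective : ∀ {x y} → x ^ q ≈ y ^ q → x ≈ y
  ^q-injective {x} {y} eq with (x - y) ≟ 0#
  ... | yes d≈0 = x∙y⁻¹≈ε⇒x≈y _ _ d≈0
  ... | no d≉0 = ⊥-elim (^-nonzero q d≉0 (+-identityˡ-unique _ _ (begin
      (x - y) ^ q + y ^ q   ≈⟨ ^q-+ (x - y) y ⟨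
      (x - y + y) ^ q       ≈⟨ ^-congˡ q (//-rightDividesˡ y x) ⟩
      x ^ q                 ≈⟨ eq ⟩
      y ^ q                 ∎)))
    where open import Algebra.Properties.Ring ring using (//-rightDividesˡ; +-identityˡ-unique)

  frobenius : Automorphism
  frobenius = record
    { ⟦_⟧               = _^ q
    ; isRingIsomorphism = mkIsRingIsomorphism K K (_^ q) (^-congˡ q) ^q-+
        (λ x y → ^-distrib-* x y q) (1^ q) ^q-injective
        (EK.injective⇒surjective (_^ q) (^-congˡ q) ^q-injective)
    ; fixes-base        = λ x → trans (sym (ι-^ x q)) (⟦⟧-cong (Fk.fermat x))
    }

  open Group galoisGroup using () renaming (rawMonoid to galoisRawMonoid; _≈_ to _≗_; setoid to galoisSetoid)

  frobenius^_ : ℕ → Automorphism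
  frobenius^ i = times galoisRawMonoid i frobenius

  frobenius^-power : ∀ i x → ⟦ frobenius^ i ⟧ x ≈ x ^ (q ℕ.^ i)
  frobenius^-power zero    x = sym (*-identityʳ x)
  frobenius^-power (suc i) x = begin
    (⟦ frobenius^ i ⟧ x) ^ q    ≈⟨ ^-congˡ q (frobenius^-power i x) ⟩
    (x ^ (q ℕ.^ i)) ^ q         ≈⟨ ^-assocʳ x (q ℕ.^ i) q ⟩
    x ^ (q ℕ.^ i ℕ.* q)         ≡⟨ ≡.cong (x ^_) (ℕ.*-comm (q ℕ.^ i) q) ⟩
    x ^ (q ℕ.^ suc i)           ∎

  private
    module U = AbelianGroup (units K)
    module U^ = Powers (units K)

  q^-mono-< : ∀ {i j} → i ℕ.< j → q ℕ.^ i ℕ.< q ℕ.^ j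
  q^-mono-< = ℕ.^-monoʳ-< q Fk.n≥2

  frobenius-order : ∀ d → 0 ℕ.< d → d ℕ.< f → ¬ (∀ x → x ^ (q ℕ.^ d) ≈ x)
  frobenius-order d 0<d d<f fixed = ℕ.<⇒≱ (ℕ.∸-monoˡ-< (q^-mono-< d<f) (ℕ.<⇒≤ 1<qᵈ))
    (FK.unit-unity-roots (ℕ.m<n⇒0<n∸m 1<qᵈ) FK.Ufin.enum FK.Ufin.enum-injective (λ i → root (FK.Ufin.enum i)))
    where
    1<qᵈ : 1 ℕ.< q ℕ.^ d
    1<qᵈ = q^-mono-< 0<d
    root : ∀ u → u U^.^ (q ℕ.^ d ℕ.∸ 1) U.≈ U.ε
    root u@(x , x≉0) = *-cancelˡ-nonzero x≉0 (begin
      x * proj₁ (u U^.^ (q ℕ.^ d ℕ.∸ 1))   ≡⟨ FK.unit-^ u (suc (q ℕ.^ d ℕ.∸ 1)) ⟩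
      x ^ suc (q ℕ.^ d ℕ.∸ 1)              ≡⟨ ≡.cong (x ^_) (ℕ.m+[n∸m]≡n (ℕ.<⇒≤ 1<qᵈ)) ⟩
      x ^ (q ℕ.^ d)                        ≈⟨ fixed x ⟩
      x                                    ≈⟨ *-identityʳ x ⟨
      x * 1#                               ∎)

  ^qⁱ-injective : ∀ i {x y} → x ^ (q ℕ.^ i) ≈ y ^ (q ℕ.^ i) → x ≈ y
  ^qⁱ-injective i {x} {y} eq = Fr.injective (trans (frobenius^-power i x) (trans eq (sym (frobenius^-power i y))))
    where module Fr = Automorphism (frobenius^ i)

  frobenius^-< : ∀ {i j} → i ℕ.< j → j ℕ.< f → ¬ ((frobenius^ i) ≗ (frobenius^ j))
  frobenius^-< {i} {j} i<j j<f eq =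
    frobenius-order (j ℕ.∸ i) (ℕ.m<n⇒0<n∸m i<j) (ℕ.≤-<-trans (ℕ.m∸n≤m j i) j<f) λ x →
      ^qⁱ-injective i (begin
        (x ^ (q ℕ.^ (j ℕ.∸ i))) ^ (q ℕ.^ i)   ≈⟨ ^-assocʳ x (q ℕ.^ (j ℕ.∸ i)) (q ℕ.^ i) ⟩
        x ^ (q ℕ.^ (j ℕ.∸ i) ℕ.* q ℕ.^ i)     ≡⟨ ≡.cong (x ^_) (ℕ.^-distribˡ-+-* q (j ℕ.∸ i) i) ⟨
        x ^ (q ℕ.^ (j ℕ.∸ i ℕ.+ i))           ≡⟨ ≡.cong (λ t → x ^ (q ℕ.^ t)) (ℕ.m∸n+n≡m (ℕ.<⇒≤ i<j)) ⟩
        x ^ (q ℕ.^ j)                         ≈⟨ frobenius^-power j x ⟨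
        ⟦ frobenius^ j ⟧ x                    ≈⟨ eq x ⟨
        ⟦ frobenius^ i ⟧ x                    ≈⟨ frobenius^-power i x ⟩
        x ^ (q ℕ.^ i)                         ∎)

  frobenius^-injective : ∀ (i j : Fin f) → (frobenius^ toℕ i) ≗ (frobenius^ toℕ j) → i ≡ j
  frobenius^-injective i j eq with ℕ.<-cmp (toℕ i) (toℕ j)
  ... | tri< i<j _ _ = ⊥-elim (frobenius^-< i<j (Fin.toℕ<n j) eq)
  ... | tri≈ _ i≡j _ = Fin.toℕ-injective i≡j
  ... | tri> _ _ j<i = ⊥-elim (frobenius^-< j<i (Fin.toℕ<n i) (λ x → sym (eq x)))

  _≗?_ : ∀ σ τ → Dec (σ ≗ τ)
  σ ≗? τ = map′ (λ eq x → trans (⟦σ⟧-cong (sym (EK.enum-index x)))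
                            (trans (eq (EK.index x)) (⟦τ⟧-cong (EK.enum-index x))))
                (λ eq i → eq (EK.enum i))
                (Fin.all? (λ i → ⟦ σ ⟧ (EK.enum i) ≟ ⟦ τ ⟧ (EK.enum i)))
    where
    open Automorphism σ using () renaming (⟦⟧-cong to ⟦σ⟧-cong)
    open Automorphism τ using () renaming (⟦⟧-cong to ⟦τ⟧-cong)

  superposition : ∀ {n} → (Fin n → Automorphism) → (Fin n → Carrier) → Carrier → Carrier
  superposition χ c x = sum λ i → c i * ⟦ χ i ⟧ x

  separating : ∀ {σ τ} → ¬ σ ≗ τ → ∃ λ y → ¬ ⟦ σ ⟧ y ≈ ⟦ τ ⟧ y
  separating {σ} {τ} σ≠τ with Fin.any? (λ i → ¬? (⟦ σ ⟧ (EK.enum i) ≟ ⟦ τ ⟧ (EK.enum i)))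
  ... | yes (i , differ) = EK.enum i , differ
  ... | no agree = ⊥-elim (σ≠τ λ x → trans (Automorphism.⟦⟧-cong σ (sym (EK.enum-index x)))
          (trans (decidable-stable (_ ≟ _) (λ differ → agree (EK.index x , differ)))
                 (Automorphism.⟦⟧-cong τ (EK.enum-index x))))

  dedekind : ∀ {n} (χ : Fin n → Automorphism) → (∀ {i j} → ¬ i ≡ j → ¬ χ i ≗ χ j) →
             ∀ c → (∀ x → superposition χ c x ≈ 0#) → ∀ i → c i ≈ 0#
  dedekind {suc n} χ distinct c vanishes = λ { zero → c₀≈0 ; (suc i) → cᵢ≈0 i }
    where
    open import Algebra.Properties.CommutativeSemigroup *-commutativeSemigroup using (x∙yz≈y∙xz)
    χ₀ = χ zero
    tail-vanishes : ∀ y x → superposition (χ ∘ suc) (λ i → c (suc i) * (⟦ χ (suc i) ⟧ y - ⟦ χ₀ ⟧ y)) x ≈ 0#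
    tail-vanishes y x = +-identityˡ-unique′ (begin
      tail-sum + ⟦ χ₀ ⟧ y * superposition (χ ∘ suc) (c ∘ suc) x
        ≈⟨ +-congˡ (*-distribˡ-sum {n} (⟦ χ₀ ⟧ y) _) ⟩
      tail-sum + sum {n} (λ i → ⟦ χ₀ ⟧ y * (c (suc i) * ⟦ χ (suc i) ⟧ x))
        ≈⟨ ∑-distrib-+ {n} _ _ ⟨
      sum {n} (λ i → c (suc i) * (⟦ χ (suc i) ⟧ y - ⟦ χ₀ ⟧ y) * ⟦ χ (suc i) ⟧ x
                     + ⟦ χ₀ ⟧ y * (c (suc i) * ⟦ χ (suc i) ⟧ x))
        ≈⟨ sum-cong-≋ {n} (λ i → termwise (c (suc i)) (⟦ χ (suc i) ⟧ y) (⟦ χ₀ ⟧ y) (⟦ χ (suc i) ⟧ x)) ⟩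
      sum {n} (λ i → c (suc i) * (⟦ χ (suc i) ⟧ y * ⟦ χ (suc i) ⟧ x))
        ≈⟨ sum-cong-≋ {n} (λ i → *-congˡ (sym (Automorphism.*-homo (χ (suc i)) y x))) ⟩
      superposition (χ ∘ suc) (c ∘ suc) (y * x)
        ≈⟨ +-cancelˡ (c zero * ⟦ χ₀ ⟧ (y * x)) _ _ (begin
             superposition χ c (y * x)                                ≈⟨ vanishes (y * x) ⟩
             0#                                                       ≈⟨ zeroʳ _ ⟨
             ⟦ χ₀ ⟧ y * 0#                                            ≈⟨ *-congˡ (vanishes x) ⟨
             ⟦ χ₀ ⟧ y * superposition χ c x                           ≈⟨ distribˡ _ _ _ ⟩
             ⟦ χ₀ ⟧ y * (c zero * ⟦ χ₀ ⟧ x) + ⟦ χ₀ ⟧ y * superposition (χ ∘ suc) (c ∘ suc) x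
               ≈⟨ +-congʳ (x∙yz≈y∙xz _ _ _) ⟩
             c zero * (⟦ χ₀ ⟧ y * ⟦ χ₀ ⟧ x) + ⟦ χ₀ ⟧ y * superposition (χ ∘ suc) (c ∘ suc) x
               ≈⟨ +-congʳ (*-congˡ (Automorphism.*-homo χ₀ y x)) ⟨
             c zero * ⟦ χ₀ ⟧ (y * x) + ⟦ χ₀ ⟧ y * superposition (χ ∘ suc) (c ∘ suc) x ∎) ⟩
      ⟦ χ₀ ⟧ y * superposition (χ ∘ suc) (c ∘ suc) x ∎)
      where
      open import Algebra.Properties.Ring ring using (+-cancelˡ; +-identityˡ-unique; //-rightDividesˡ)
      tail-sum = superposition (χ ∘ suc) (λ i → c (suc i) * (⟦ χ (suc i) ⟧ y - ⟦ χ₀ ⟧ y)) x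
      +-identityˡ-unique′ : ∀ {x y} → x + y ≈ y → x ≈ 0#
      +-identityˡ-unique′ = +-identityˡ-unique _ _
      termwise : ∀ a u v z → a * (u - v) * z + v * (a * z) ≈ a * (u * z)
      termwise a u v z = begin
        a * (u - v) * z + v * (a * z)      ≈⟨ +-cong (*-assoc _ _ _) (x∙yz≈y∙xz v a z) ⟩
        a * ((u - v) * z) + a * (v * z)    ≈⟨ distribˡ a _ _ ⟨
        a * ((u - v) * z + v * z)          ≈⟨ *-congˡ (distribʳ z _ _) ⟨
        a * ((u - v + v) * z)              ≈⟨ *-congˡ (*-congʳ (//-rightDividesˡ v u)) ⟩
        a * (u * z)                        ∎
    cᵢ≈0 : ∀ i → c (suc i) ≈ 0#
    cᵢ≈0 i = let (y , differ) = separating {χ (suc i)} {χ₀} (distinct λ ()) in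
      x*y≈0⇒y≈0 (differ ∘ x∙y⁻¹≈ε⇒x≈y _ _)
        (trans (*-comm _ _) (dedekind (χ ∘ suc) (λ i≢j → distinct (i≢j ∘ Fin.suc-injective)) _ (tail-vanishes y) i))
    c₀≈0 : c zero ≈ 0#
    c₀≈0 = begin
      c zero                       ≈⟨ *-identityʳ _ ⟨
      c zero * 1#                  ≈⟨ *-congˡ (Automorphism.1#-homo χ₀) ⟨
      c zero * ⟦ χ₀ ⟧ 1#           ≈⟨ +-identityʳ _ ⟨
      c zero * ⟦ χ₀ ⟧ 1# + 0#      ≈⟨ +-congˡ (trans (sum-cong-≋ {n} (λ i → trans (*-congʳ (cᵢ≈0 i)) (zeroˡ _))) (sum-replicate-zero n)) ⟨
      superposition χ c 1#         ≈⟨ vanishes 1# ⟩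
      0#                           ∎

  superposition-vanishes : ∀ {n} (χ : Fin n → Automorphism) c →
    (∀ j → superposition χ c (basis j) ≈ 0#) → ∀ x → superposition χ c x ≈ 0#
  superposition-vanishes {n} χ c on-basis x =
    trans (sp-cong (sym (proj₂ (spanning x)))) (on-sum f _ (λ j → on-multiple (proj₁ (spanning x) j) (on-basis j)))
    where
    open import Algebra.Properties.CommutativeSemigroup *-commutativeSemigroup using (x∙yz≈y∙xz)
    sp = superposition χ c
    sp-cong : ∀ {x y} → x ≈ y → sp x ≈ sp y
    sp-cong eq = sum-cong-≋ {n} (λ i → *-congˡ (Automorphism.⟦⟧-cong (χ i) eq))
    on-multiple : ∀ a {x} → sp x ≈ 0# → sp (ι a * x) ≈ 0#
    on-multiple a {x} eq = begin
      sp (ι a * x)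
        ≈⟨ sum-cong-≋ {n} (λ i → trans (*-congˡ (trans (Automorphism.*-homo (χ i) _ _)
             (*-congʳ (Automorphism.fixes-base (χ i) a)))) (x∙yz≈y∙xz _ _ _)) ⟩
      sum {n} (λ i → ι a * (c i * ⟦ χ i ⟧ x))   ≈⟨ *-distribˡ-sum {n} (ι a) _ ⟨
      ι a * sp x                                ≈⟨ *-congˡ eq ⟩
      ι a * 0#                                  ≈⟨ zeroʳ _ ⟩
      0#                                        ∎
    on-sum : ∀ m (t : Fin m → Carrier) → (∀ j → sp (t j) ≈ 0#) → sp (sum t) ≈ 0#
    on-sum zero t eq = trans
      (sum-cong-≋ {n} (λ i → trans (*-congˡ (Automorphism.0#-homo (χ i))) (zeroʳ _))) (sum-replicate-zero n)
    on-sum (suc m) t eq = begin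
      sp (t zero + sum (t ∘ suc))
        ≈⟨ sum-cong-≋ {n} (λ i → trans (*-congˡ (Automorphism.+-homo (χ i) _ _)) (distribˡ _ _ _)) ⟩
      sum {n} (λ i → c i * ⟦ χ i ⟧ (t zero) + c i * ⟦ χ i ⟧ (sum (t ∘ suc)))
        ≈⟨ ∑-distrib-+ {n} _ _ ⟩
      sp (t zero) + sp (sum (t ∘ suc))
        ≈⟨ +-cong (eq zero) (on-sum m (t ∘ suc) (eq ∘ suc)) ⟩
      0# + 0#
        ≈⟨ +-identityˡ 0# ⟩
      0# ∎

  superposition-difference : ∀ {n} (χ : Fin n → Automorphism) c d x →
    superposition χ (λ i → c i - d i) x + superposition χ d x ≈ superposition χ c x
  superposition-difference {n} χ c d x = trans (sym (∑-distrib-+ {n} _ _))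
    (sum-cong-≋ {n} (λ i → trans (sym (distribʳ _ _ _)) (*-congʳ (//-rightDividesˡ (d i) (c i)))))
    where open import Algebra.Properties.Ring ring using (//-rightDividesˡ)

  ¬-f+1-distinct : ∀ (χ : Fin (suc f) → Automorphism) → ¬ (∀ {i j} → ¬ i ≡ j → ¬ χ i ≗ χ j)
  ¬-f+1-distinct χ distinct =
    let (m , n , m<n , eq) = Fin.pigeonhole (ℕ.^-monoʳ-< (q ℕ.^ f) FK.n≥2 (ℕ.n<1+n f)) values
    in Fin.<⇒≢ m<n (≡.trans (≡.sym (Fin.funToFin-finToFin {suc f} {q ℕ.^ f} m))
        (≡.trans (funToFin-cong (λ i → EK.enum-injective (x∙y⁻¹≈ε⇒x≈y _ _
                   (dedekind χ distinct (difference m n)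
                     (superposition-vanishes χ (difference m n) (on-basis m n eq)) i))))
                 (Fin.funToFin-finToFin {suc f} {q ℕ.^ f} n)))
    where
    coefficients : Fin ((q ℕ.^ f) ℕ.^ suc f) → Fin (suc f) → Carrier
    coefficients m = EK.enum ∘ Fin.finToFun m
    values : Fin ((q ℕ.^ f) ℕ.^ suc f) → Fin ((q ℕ.^ f) ℕ.^ f)
    values m = Fin.funToFin (λ j → EK.index (superposition χ (coefficients m) (basis j)))
    difference : ∀ m n → Fin (suc f) → Carrier
    difference m n i = coefficients m i - coefficients n i
    values-injective : ∀ m n → values m ≡ values n → ∀ j →
      superposition χ (coefficients m) (basis j) ≈ superposition χ (coefficients n) (basis j)
    values-injective m n eq j = EK.index-injective
      (≡.trans (≡.sym (Fin.finToFun-funToFin _ j))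
        (≡.trans (≡.cong (λ v → Fin.finToFun v j) eq) (Fin.finToFun-funToFin _ j)))
    on-basis : ∀ m n → values m ≡ values n → ∀ j → superposition χ (difference m n) (basis j) ≈ 0#
    on-basis m n eq j = +-identityˡ-unique _ _
      (trans (superposition-difference χ (coefficients m) (coefficients n) (basis j)) (values-injective m n eq j))
      where open import Algebra.Properties.Ring ring using (+-identityˡ-unique)

  frobenius-generates : ∀ σ → ∃ λ (i : Fin f) → (frobenius^ toℕ i) ≗ σ
  frobenius-generates σ with Fin.any? (λ i → (frobenius^ toℕ i) ≗? σ)
  ... | yes found = found
  ... | no none = ⊥-elim (¬-f+1-distinct χ distinct)
    where
    χ : Fin (suc f) → Automorphism
    χ zero    = σ
    χ (suc i) = frobenius^ toℕ i
    distinct : ∀ {i j} → ¬ i ≡ j → ¬ χ i ≗ χ j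
    distinct {zero}  {zero}  i≢j eq = i≢j ≡.refl
    distinct {zero}  {suc j} i≢j eq = none (j , λ x → sym (eq x))
    distinct {suc i} {zero}  i≢j eq = none (i , eq)
    distinct {suc i} {suc j} i≢j eq = i≢j (≡.cong suc (frobenius^-injective i j eq))

  galoisGroup-enumeration : galoisSetoid HasCardinality f
  galoisGroup-enumeration = record
    { to        = λ i → frobenius^ toℕ i
    ; from      = λ σ → proj₁ (frobenius-generates σ)
    ; to-cong   = λ { ≡.refl x → refl }
    ; from-cong = λ {σ} {τ} eq → frobenius^-injective _ _ λ x →
        trans (proj₂ (frobenius-generates σ) x) (trans (eq x) (sym (proj₂ (frobenius-generates τ) x)))
    ; inverse   = (λ { {σ} ≡.refl x → proj₂ (frobenius-generates σ) x })
                , (λ {i} {σ} eq → frobenius^-injective _ _ λ x → trans (proj₂ (frobenius-generates σ) x) (eq x))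
    }

  fixed⇒base : ∀ x → x ^ q ≈ x → ∃ λ y → ι y ≈ x
  fixed⇒base x fixed with Fin.any? (λ i → ι (Ek.enum i) ≟ x)
  ... | yes (i , eq) = Ek.enum i , eq
  ... | no none = ⊥-elim (ℕ.1+n≰n (unity-roots Fk.n-1>0 roots roots-injective are-roots))
    where
    open Polynomial K using (unity-roots)
    x≉0 : ¬ x ≈ 0#
    x≉0 x≈0 = none (Ek.index k.0# , trans (⟦⟧-cong (Ek.enum-index k.0#)) (trans 0#-homo (sym x≈0)))
    roots : Fin (suc (q ℕ.∸ 1)) → Carrier
    roots zero    = x
    roots (suc i) = ι (proj₁ (Fk.Ufin.enum i))
    ι≉x : ∀ y → ¬ ι y ≈ x
    ι≉x y eq = none (Ek.index y , trans (⟦⟧-cong (Ek.enum-index y)) eq)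
    roots-injective : Injective _≡_ _≈_ roots
    roots-injective {zero}  {zero}  eq = ≡.refl
    roots-injective {zero}  {suc j} eq = ⊥-elim (ι≉x _ (sym eq))
    roots-injective {suc i} {zero}  eq = ⊥-elim (ι≉x _ eq)
    roots-injective {suc i} {suc j} eq = ≡.cong suc (Fk.Ufin.enum-injective (ι-injective eq))
    are-roots : ∀ i → roots i ^ (q ℕ.∸ 1) ≈ 1#
    are-roots zero = *-cancelˡ-nonzero x≉0 (begin
      x ^ suc (q ℕ.∸ 1)   ≡⟨ ≡.cong (x ^_) Fk.1+[n-1]≡n ⟩
      x ^ q               ≈⟨ fixed ⟩
      x                   ≈⟨ *-identityʳ x ⟨
      x * 1#              ∎)
    are-roots (suc i) = begin
      ι (proj₁ u) ^ (q ℕ.∸ 1)    ≈⟨ ι-^ (proj₁ u) (q ℕ.∸ 1) ⟨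
      ι (proj₁ u k.^ (q ℕ.∸ 1))  ≈⟨ ⟦⟧-cong (k.trans (k.reflexive (≡.sym (Fk.unit-^ u (q ℕ.∸ 1)))) (Fk.units-lagrange u)) ⟩
      ι k.1#                     ≈⟨ 1#-homo ⟩
      1#                         ∎
      where u = Fk.Ufin.enum i

module NormMap
  {k : Field c ℓ} {K : Field a ℓ₁} {q f : ℕ} (f>0 : 0 ℕ.< f)
  (k-finite : Field.setoid k HasCardinality q)
  (extension : FieldExtension k K f)
  where
  private
    module k = Field k
    module K = Field K
    module kˣ = AbelianGroup (units k)
    module FE = FiniteFieldExtension f>0 k-finite extension
  open FE using (galoisGroup-enumeration; frobenius; frobenius^_; frobenius^-power; fixed⇒base; q>0; module FK)
  open FieldExtension extension using (ι; ⟦⟧-cong; 0#-homo)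
  open GaloisGroup extension using (galoisGroup; unitsModule)

  open GModule unitsModule public
  open MonoidSum commutativeMonoid public using () renaming (sum to product)
  open MonoidSum commutativeMonoid using () renaming (sum-cong-≋ to product-cong)
  open SetoidReasoning setoid

  ιˣ : kˣ.Carrier → Carrier
  ιˣ (x , x≉0) = ι x , FE.ι-nonzero x≉0

  -- The product of σ x over all σ ∈ Gal(K|k).
  conjugate-product : Carrier → Carrier
  conjugate-product x = product λ i → Inverse.to galoisGroup-enumeration i · x

  frobenius^-· : ∀ i x → (frobenius^ i) · x ≈ x ^ (q ℕ.^ i)
  frobenius^-· i x = K.trans (frobenius^-power i (proj₁ x)) (K.reflexive (≡.sym (FK.unit-^ x (q ℕ.^ i))))

  conjugate-product-power : ∀ x → conjugate-product x ≈ x ^ geometric q f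
  conjugate-product-power x = begin
    conjugate-product x                             ≈⟨ product-cong {f} (λ i → frobenius^-· (toℕ i) x) ⟩
    product {f} (λ i → x ^ (q ℕ.^ toℕ i))           ≈⟨ product-^ x f (λ i → q ℕ.^ toℕ i) ⟩
    x ^ geometric q f                               ∎

  ^geometric-fixed : ∀ x → (x ^ geometric q f) ^ (q ℕ.∸ 1) ≈ ε
  ^geometric-fixed x = begin
    (x ^ geometric q f) ^ (q ℕ.∸ 1)    ≈⟨ ^-* x (geometric q f) (q ℕ.∸ 1) ⟩
    x ^ (geometric q f ℕ.* (q ℕ.∸ 1))  ≈⟨ ^-reflexive x (≡.trans (ℕ.*-comm (geometric q f) (q ℕ.∸ 1)) ([q-1]*geometric q f q>0)) ⟩
    x ^ (q ℕ.^ f ℕ.∸ 1)                ≈⟨ FK.units-lagrange x ⟩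
    ε                                  ∎

  conjugate-product-^[q-1] : ∀ x → conjugate-product x ^ (q ℕ.∸ 1) ≈ ε
  conjugate-product-^[q-1] x =
    trans {conjugate-product x ^ (q ℕ.∸ 1)} {(x ^ geometric q f) ^ (q ℕ.∸ 1)} {ε}
      (^-cong (q ℕ.∸ 1) {conjugate-product x} {x ^ geometric q f} (conjugate-product-power x)) (^geometric-fixed x)

  conjugate-product∈k : ∀ x → ∃ λ y → ι y K.≈ proj₁ (conjugate-product x)
  conjugate-product∈k x = fixed⇒base (proj₁ N) (K.trans
    (K.reflexive (≡.trans (≡.cong (proj₁ N K.^_) (≡.sym 1+[q-1]≡q)) (≡.sym (FK.unit-^ N (suc (q ℕ.∸ 1))))))
    (K.trans (K.*-congˡ (conjugate-product-^[q-1] x)) (K.*-identityʳ (proj₁ N))))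
    where
    N = conjugate-product x
    1+[q-1]≡q : suc (q ℕ.∸ 1) ≡ q
    1+[q-1]≡q = ℕ.m+[n∸m]≡n q>0

  norm : Carrier → kˣ.Carrier
  norm x = proj₁ (conjugate-product∈k x) , λ y≈0 → proj₂ (conjugate-product x)
    (K.trans (K.sym (proj₂ (conjugate-product∈k x))) (K.trans (⟦⟧-cong y≈0) 0#-homo))

  ι-norm : ∀ x → ιˣ (norm x) ≈ conjugate-product x
  ι-norm x = proj₂ (conjugate-product∈k x)

  ι-norm-power : ∀ x → ιˣ (norm x) ≈ x ^ geometric q f
  ι-norm-power x = trans {ιˣ (norm x)} {conjugate-product x} {x ^ geometric q f} (ι-norm x) (conjugate-product-power x)

  units-cyclic : ∃ λ g → Order.HasOrder abelianGroup g (q ℕ.^ f ℕ.∸ 1) × ∀ x → ∃ λ i → x ≈ g ^ i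
  units-cyclic = CyclicCriterion.cyclic abelianGroup FK.units-finite FK.n-1>0 FK.unit-unity-roots

module Setup
  {k : Field c ℓ} {K : Field a ℓ₁} {q f : ℕ} (f>0 : 0 ℕ.< f)
  (k-finite : Field.setoid k HasCardinality q)
  (extension : FieldExtension k K f)
  {e : ℕ} (e>0 : 0 ℕ.< e) (q^f≡1[e] : e ∣ q ℕ.^ f ℕ.∸ 1)
  where
  open NormMap f>0 k-finite extension public
  open FiniteFieldExtension f>0 k-finite extension using (frobenius; frobenius^_; frobenius^-power; q>0; module FK)
  open GaloisGroup extension using (galoisGroup; unitsModule)
  open Cohomology {G = galoisGroup} frobenius q f public
  open SetoidReasoning setoid

  private
    module K = Field K
    instance
      e≢0 : NonZero e
      e≢0 = ℕ.>-nonZero e>0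

  Kˣ/Kˣᵉ : GModule galoisGroup (a ⊔ ℓ₁) (a ⊔ ℓ₁)
  Kˣ/Kˣᵉ = QuotientModule unitsModule e

  ₑKˣ : GModule galoisGroup (a ⊔ ℓ₁) ℓ₁
  ₑKˣ = TorsionModule unitsModule e

  frobenius-power : ∀ x → frobenius · x ≈ x ^ q
  frobenius-power x = K.reflexive (≡.sym (FK.unit-^ x q))

  image⊆kernel : (C : GModule galoisGroup b ℓ₂) → ActsByPower C →
                 let module C = GModule C in
                 ∀ z → (z C.^ geometric q f) C.^ (q ℕ.∸ 1) C.≈ C.ε
  image⊆kernel C C-power z =
    C.trans (C.^-* z (geometric q f) (q ℕ.∸ 1))
      (C.trans (C.^-reflexive z (≡.trans (ℕ.*-comm (geometric q f) (q ℕ.∸ 1)) ([q-1]*geometric q f q>0)))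
        (identityʳ-unique z _
          (C.trans (C.^-reflexive z (ℕ.m+[n∸m]≡n (ℕ.m^n>0 q {{ℕ.>-nonZero q>0}} f)))
            (C.trans (C.sym (iterate f))
              (C.trans (C.·-cong (λ x → K.trans (frobenius^-power f x) (FK.fermat x)) C.refl) (C.ε-· z))))))
    where
    module C = GModule C
    open import Algebra.Properties.Group C.group using (identityʳ-unique)
    iterate : ∀ i → (frobenius^ i) C.· z C.≈ z C.^ (q ℕ.^ i)
    iterate zero    = C.trans (C.ε-· z) (C.sym (C.^-1 z))
    iterate (suc i) = C.trans (C.∙-· frobenius (frobenius^ i) z)
      (C.trans (C.·-congˡ frobenius (iterate i))
        (C.trans (C-power _)
          (C.trans (C.^-* z (q ℕ.^ i) q) (C.^-reflexive z (ℕ.*-comm (q ℕ.^ i) q)))))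

  quotient-^ : ∀ x n → GModule._^_ Kˣ/Kˣᵉ x n ≡ x ^ n
  quotient-^ x zero    = ≡.refl
  quotient-^ x (suc n) = ≡.cong (x ∙_) (quotient-^ x n)

  Kˣ/Kˣᵉ-power : ActsByPower Kˣ/Kˣᵉ
  Kˣ/Kˣᵉ-power x = ε , (begin
    frobenius · x                       ≈⟨ frobenius-power x ⟩
    x ^ q                               ≡⟨ quotient-^ x q ⟨
    GModule._^_ Kˣ/Kˣᵉ x q              ≈⟨ identityʳ (GModule._^_ Kˣ/Kˣᵉ x q) ⟨
    GModule._^_ Kˣ/Kˣᵉ x q ∙ ε          ≈⟨ ∙-congˡ {GModule._^_ Kˣ/Kˣᵉ x q} {ε ^ e} {ε} (ε^ e) ⟨
    GModule._^_ Kˣ/Kˣᵉ x q ∙ ε ^ e      ∎)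

  torsion-^ : ∀ x n → proj₁ (GModule._^_ ₑKˣ x n) ≡ proj₁ x ^ n
  torsion-^ x zero    = ≡.refl
  torsion-^ x (suc n) = ≡.cong (proj₁ x ∙_) (torsion-^ x n)

  ₑKˣ-power : ActsByPower ₑKˣ
  ₑKˣ-power x = begin
    frobenius · proj₁ x            ≈⟨ frobenius-power (proj₁ x) ⟩
    proj₁ x ^ q                    ≡⟨ torsion-^ x q ⟨
    proj₁ (GModule._^_ ₑKˣ x q)    ∎

  exponent : ℕ
  exponent = (q ℕ.^ f ℕ.∸ 1) / e

  Kˣ/Kˣᵉ≅ₑKˣ : GModuleIsomorphism Kˣ/Kˣᵉ ₑKˣ
  Kˣ/Kˣᵉ≅ₑKˣ =
    let (g , g-order , generates) = units-cyclic in
    power-isomorphism unitsModule e exponent {{e≢0}} {{exponent≢0}} g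
      (≡.subst (Order.HasOrder abelianGroup g) (≡.sym (m*[n/m]≡n q^f≡1[e])) g-order) generates
    where
    exponent≢0 : NonZero exponent
    exponent≢0 = ℕ.≢-nonZero λ exponent≡0 → ℕ.<⇒≢ FK.n-1>0
      (≡.trans (≡.sym (≡.trans (≡.cong (e ℕ.*_) exponent≡0) (ℕ.*-zeroʳ e))) (m*[n/m]≡n q^f≡1[e]))

  H²-Kˣ/Kˣᵉ : AbelianGroup _ _
  H²-Kˣ/Kˣᵉ = H² Kˣ/Kˣᵉ Kˣ/Kˣᵉ-power

  H²-ₑKˣ : AbelianGroup _ _
  H²-ₑKˣ = H² ₑKˣ ₑKˣ-power

  canonical : GroupIsomorphism H²-Kˣ/Kˣᵉ H²-ₑKˣ
  canonical = H²-map Kˣ/Kˣᵉ Kˣ/Kˣᵉ-power ₑKˣ ₑKˣ-power Kˣ/Kˣᵉ≅ₑKˣ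

  ξ̄^[q-1]≈1 : ∀ {ξ} → (∃ λ β → ξ ^ (q ℕ.∸ 1) ≈ β ^ e) →
              let open GModule Kˣ/Kˣᵉ renaming (_^_ to _^Q_; _≈_ to _≈Q_; ε to εQ) in
              ξ ^Q (q ℕ.∸ 1) ≈Q εQ
  ξ̄^[q-1]≈1 {ξ} (β , ξ-eq) = β , (begin
    GModule._^_ Kˣ/Kˣᵉ ξ (q ℕ.∸ 1)  ≡⟨ quotient-^ ξ (q ℕ.∸ 1) ⟩
    ξ ^ (q ℕ.∸ 1)                   ≈⟨ ξ-eq ⟩
    β ^ e                           ≈⟨ identityˡ (β ^ e) ⟨
    ε ∙ β ^ e                       ∎)

  Nα^e≈1 : ∀ {ξ α} → ξ ^ (q ℕ.∸ 1) ≈ α ^ e → ιˣ (norm α) ^ e ≈ ε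
  Nα^e≈1 {ξ} {α} ξ-eq = begin
    ιˣ (norm α) ^ e                  ≈⟨ ^-cong e {ιˣ (norm α)} {α ^ geometric q f} (ι-norm-power α) ⟩
    (α ^ geometric q f) ^ e          ≈⟨ ^-^-comm α (geometric q f) e ⟩
    (α ^ e) ^ geometric q f          ≈⟨ ^-cong (geometric q f) {ξ ^ (q ℕ.∸ 1)} {α ^ e} ξ-eq ⟨
    (ξ ^ (q ℕ.∸ 1)) ^ geometric q f  ≈⟨ ^-^-comm ξ (q ℕ.∸ 1) (geometric q f) ⟩
    (ξ ^ geometric q f) ^ (q ℕ.∸ 1)  ≈⟨ ^geometric-fixed ξ ⟩
    ε                                ∎

  Nα^[q-1]≈1 : ∀ α (ζᵉ≈1 : ιˣ (norm α) ^ e ≈ ε) →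
              let open GModule ₑKˣ renaming (_^_ to _^T_; _≈_ to _≈T_; ε to εT) in
              (ιˣ (norm α) , ζᵉ≈1) ^T (q ℕ.∸ 1) ≈T εT
  Nα^[q-1]≈1 α ζᵉ≈1 = begin
    proj₁ (GModule._^_ ₑKˣ (ιˣ (norm α) , ζᵉ≈1) (q ℕ.∸ 1))
      ≡⟨ torsion-^ (ιˣ (norm α) , ζᵉ≈1) (q ℕ.∸ 1) ⟩
    ιˣ (norm α) ^ (q ℕ.∸ 1)
      ≈⟨ ^-cong (q ℕ.∸ 1) {ιˣ (norm α)} {α ^ geometric q f} (ι-norm-power α) ⟩
    (α ^ geometric q f) ^ (q ℕ.∸ 1)
      ≈⟨ ^geometric-fixed α ⟩
    ε ∎

  class-ξ̄ : ∀ ξ → (∃ λ β → ξ ^ (q ℕ.∸ 1) ≈ β ^ e) → AbelianGroup.Carrier H²-Kˣ/Kˣᵉ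
  class-ξ̄ ξ ξ^[q-1]∈Kˣᵉ = ξ , ξ̄^[q-1]≈1 {ξ} ξ^[q-1]∈Kˣᵉ

  class-Nα : ∀ {ξ} α → ξ ^ (q ℕ.∸ 1) ≈ α ^ e → AbelianGroup.Carrier H²-ₑKˣ
  class-Nα {ξ} α ξ^[q-1]≈αᵉ = (ζ , ζᵉ≈1) , Nα^[q-1]≈1 α ζᵉ≈1
    where
    ζ = ιˣ (norm α)
    ζᵉ≈1 = Nα^e≈1 {ξ} {α} ξ^[q-1]≈αᵉ

{-# OPTIONS --safe #-}
-- Write N = q^f - 1, s = 1 + q + ⋯ + q^(f-1) and m = N / e, so that (q-1) s = e m = N.  Let g generate
-- k_f^×, with ξ = g^i and α = g^j.  Then ξ^(q-1) = α^e says i (q-1) = j e + t N for some t.  Multiplying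
-- by m and cancelling q-1 gives i m = j s + (t m) s, that is, ξ^m = N_f(α) ω^s with ω = g^(t m), and
-- ω is an e-th root of 1.
module Submission where

open import Defs
open import Algebra.Bundles using (AbelianGroup)
import Algebra.Properties.Group as GroupProperties
open import Data.Nat.Base using (ℕ; _+_; _*_; _^_; _∸_; _≤_; _>_; NonZero; >-nonZero)
open import Data.Nat.DivMod using (m*[n/m]≡n)
open import Data.Nat.Divisibility using (_∣_; divides; n∣m*n)
import Data.Nat.Properties as ℕ
open import Data.Nat.Solver using (module +-*-Solver)
open import Data.Product.Base using (∃; _×_; _,_; proj₁)
open import Relation.Binary.PropositionalEquality using (_≡_; refl; sym; trans; cong; subst; module ≡-Reasoning)
import Relation.Binary.Reasoning.Setoid as SetoidReasoning

-- The two sides are compared after multiplication by `d`: there the hypothesis applies to `i * d`,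
-- and `e * m` can be traded for `d * s`.
cancel-exponents : ∀ i j t d e m s .{{_ : NonZero d}} → d * s ≡ e * m →
                   i * d ≡ j * e + t * (d * s) → i * m ≡ j * s + t * m * s
cancel-exponents i j t d e m s ds≡em eq = ℕ.*-cancelʳ-≡ _ _ d (begin
  i * m * d                          ≡⟨ solve 3 (λ i m d → i :* m :* d := i :* d :* m) refl i m d ⟩
  i * d * m                          ≡⟨ cong (_* m) eq ⟩
  (j * e + t * (d * s)) * m          ≡⟨ solve 6 (λ j e t d s m → (j :* e :+ t :* (d :* s)) :* m
                                          := j :* (e :* m) :+ t :* m :* s :* d) refl j e t d s m ⟩
  j * (e * m) + t * m * s * d        ≡⟨ cong (λ n → j * n + t * m * s * d) ds≡em ⟨
  j * (d * s) + t * m * s * d        ≡⟨ solve 5 (λ j d s t m → j :* (d :* s) :+ t :* m :* s :* d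
                                          := (j :* s :+ t :* m :* s) :* d) refl j d s t m ⟩
  (j * s + t * m * s) * d            ∎)
  where
  open ≡-Reasoning
  open +-*-Solver

module _ {c ℓ} (A : AbelianGroup c ℓ) where
  open AbelianGroup A using (_≈_; _∙_; ε; group; setoid; identityʳ; ∙-cong; ∙-congˡ; ∙-congʳ)
    renaming (trans to ≈-trans)
  open Powers A using (^-cong; ^-+; ^-*; ^-∣; ^-reflexive) renaming (_^_ to _^ᴬ_)
  open Order A using (HasOrder)
  open GroupProperties group using (identityʳ-unique)
  open SetoidReasoning setoid

  -- The order divides `i ∸ j`. The bound `j ≤ i` makes the truncated difference a true one, so that
  -- `t` can be a natural number.
  equal-powers : ∀ {g n i j} → HasOrder g n → j ≤ i → g ^ᴬ i ≈ g ^ᴬ j → ∃ λ t → i ≡ j + t * n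
  equal-powers {g} {n} {i} {j} (_ , g-min) j≤i eq
    with divides t i∸j≡tn ← g-min (i ∸ j) (identityʳ-unique (g ^ᴬ j) _ (begin
      g ^ᴬ j ∙ g ^ᴬ (i ∸ j)  ≈⟨ ^-+ g j (i ∸ j) ⟨
      g ^ᴬ (j + (i ∸ j))     ≈⟨ ^-reflexive g (ℕ.m+[n∸m]≡n j≤i) ⟩
      g ^ᴬ i                 ≈⟨ eq ⟩
      g ^ᴬ j                 ∎))
    = t , trans (sym (ℕ.m+[n∸m]≡n j≤i)) (cong (j +_) i∸j≡tn)

  -- Exponents are natural numbers, so before subtracting one from another the larger has to be made
  -- large enough. Adding `b` periods does this because `n ≥ 1`.
  large-exponent : ∀ {g n} .{{_ : NonZero n}} → g ^ᴬ n ≈ ε → ∀ i b → ∃ λ i′ → b ≤ i′ × g ^ᴬ i ≈ g ^ᴬ i′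
  large-exponent {g} {n} gⁿ≈ε i b = i + b * n , ℕ.≤-trans (ℕ.m≤m*n b n) (ℕ.m≤n+m (b * n) i) , (begin
    g ^ᴬ i                  ≈⟨ identityʳ _ ⟨
    g ^ᴬ i ∙ ε              ≈⟨ ∙-congˡ (^-∣ g (n∣m*n b) gⁿ≈ε) ⟨
    g ^ᴬ i ∙ g ^ᴬ (b * n)   ≈⟨ ^-+ g i (b * n) ⟨
    g ^ᴬ (i + b * n)        ∎)

  -- The comparison of logarithms to base `g`, in any cyclic group of order `d * s = e * m`.
  cyclic-power-transfer :
    ∀ {g d e m s} .{{_ : NonZero (d * s)}} → HasOrder g (d * s) → (∀ x → ∃ λ i → x ≈ g ^ᴬ i) →
    d * s ≡ e * m → ∀ {x y} → x ^ᴬ d ≈ y ^ᴬ e →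
    ∃ λ w → w ^ᴬ e ≈ ε × x ^ᴬ m ≈ y ^ᴬ s ∙ w ^ᴬ s
  cyclic-power-transfer {g} {d} {e} {m} {s} order@(gᴺ≈ε , _) generates ds≡em {x} {y} xᵈ≈yᵉ
    with i₀ , x≈gⁱ⁰ ← generates x | j , y≈gʲ ← generates y
    -- Since `d ≥ 1`, the bound `j * e ≤ i` gives `j * e ≤ i * d`, as `equal-powers` requires.
    with i , je≤i , gⁱ⁰≈gⁱ ← large-exponent gᴺ≈ε i₀ (j * e)
    with t , id≡je+tds ← equal-powers order (ℕ.≤-trans je≤i (ℕ.m≤m*n i d {{ℕ.m*n≢0⇒m≢0 d}})) (begin
      g ^ᴬ (i * d)      ≈⟨ ^-* g i d ⟨
      (g ^ᴬ i) ^ᴬ d     ≈⟨ ^-cong d (≈-trans x≈gⁱ⁰ gⁱ⁰≈gⁱ) ⟨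
      x ^ᴬ d            ≈⟨ xᵈ≈yᵉ ⟩
      y ^ᴬ e            ≈⟨ ^-cong e y≈gʲ ⟩
      (g ^ᴬ j) ^ᴬ e     ≈⟨ ^-* g j e ⟩
      g ^ᴬ (j * e)      ∎)
    -- The excess exponent `t * m * s` is a multiple of `s`, and its cofactor `t * m` becomes a
    -- multiple of the group order when multiplied by `e`.
    = g ^ᴬ (t * m) , wᵉ≈ε , (begin
      x ^ᴬ m                              ≈⟨ ^-cong m (≈-trans x≈gⁱ⁰ gⁱ⁰≈gⁱ) ⟩
      (g ^ᴬ i) ^ᴬ m                       ≈⟨ ^-* g i m ⟩
      g ^ᴬ (i * m)                        ≈⟨ ^-reflexive g im≡js+tms ⟩
      g ^ᴬ (j * s + t * m * s)            ≈⟨ ^-+ g (j * s) (t * m * s) ⟩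
      g ^ᴬ (j * s) ∙ g ^ᴬ (t * m * s)     ≈⟨ ∙-cong (^-* g j s) (^-* g (t * m) s) ⟨
      (g ^ᴬ j) ^ᴬ s ∙ (g ^ᴬ (t * m)) ^ᴬ s ≈⟨ ∙-congʳ (^-cong s y≈gʲ) ⟨
      y ^ᴬ s ∙ (g ^ᴬ (t * m)) ^ᴬ s        ∎)
    where
    im≡js+tms : i * m ≡ j * s + t * m * s
    im≡js+tms = cancel-exponents i j t d e m s {{ℕ.m*n≢0⇒m≢0 d}} ds≡em id≡je+tds
    wᵉ≈ε : (g ^ᴬ (t * m)) ^ᴬ e ≈ ε
    wᵉ≈ε = ≈-trans (^-* g (t * m) e)
      (^-∣ g (divides t (trans (ℕ.*-assoc t m e) (cong (t *_) (trans (ℕ.*-comm m e) (sym ds≡em))))) gᴺ≈ε)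

proposition2p2p1 : ∀ {c ℓ c′ ℓ′}
    (k : Field c ℓ) (q : ℕ) (k-finite : Field.setoid k HasCardinality q)
    (f : ℕ) (f>0 : f > 0)
    (kf : Field c′ ℓ′) (kf/k : FieldExtension k kf f)
    (e : ℕ) (e>0 : e > 0) (q^f≡1[mod-e] : e ∣ q ^ f ∸ 1) →
    let open Setup f>0 k-finite kf/k e>0 q^f≡1[mod-e] renaming (_^_ to _^ˣ_) in
    (ξ : Carrier) (ξ^[q-1]∈kfˣᵉ : ∃ λ β → ξ ^ˣ (q ∸ 1) ≈ β ^ˣ e)
    (α : Carrier) (ξ^[q-1]≈αᵉ : ξ ^ˣ (q ∸ 1) ≈ α ^ˣ e) →
    AbelianGroup._≈_ H²-ₑKˣ
    (GroupIsomorphism.⟦_⟧ canonical (class-ξ̄ ξ ξ^[q-1]∈kfˣᵉ))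
    (class-Nα {ξ} α ξ^[q-1]≈αᵉ)
proposition2p2p1 k q k-finite f f>0 kf kf/k e e>0 q^f≡1[mod-e] ξ _ α ξ^[q-1]≈αᵉ =
  let (g , g-order , generates) = S.units-cyclic
      (w , wᵉ≈ε , ξᵐ≈αˢwˢ) = cyclic-power-transfer S.abelianGroup
        {g} {q ∸ 1} {e} {S.exponent} {s} {{subst NonZero (sym ds≡N) (>-nonZero FK.n-1>0)}}
        (subst (Order.HasOrder S.abelianGroup g) (sym ds≡N) g-order) generates
        (trans ds≡N (sym (m*[n/m]≡n {{>-nonZero e>0}} q^f≡1[mod-e]))) {ξ} {α} ξ^[q-1]≈αᵉ
  -- Classes in `H²-ₑKˣ` agree modulo `s`-th powers of elements of `ₑKˣ`, so the witness has to
  -- carry a proof that `w` is an `e`-th root of 1.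
  in (w , wᵉ≈ε) , (begin
    ξ S.^ S.exponent                                ≈⟨ ξᵐ≈αˢwˢ ⟩
    -- The conjugates of `α` are its powers with exponents `1, q, ..., q^(f-1)`, so its norm is `α`
    -- to the power `s`.
    α S.^ s S.∙ w S.^ s                             ≈⟨ S.∙-congʳ {w S.^ s} {ζ} {α S.^ s} (S.ι-norm-power α) ⟨
    ζ S.∙ w S.^ s                                   ≡⟨ cong (ζ S.∙_) (S.torsion-^ (w , wᵉ≈ε) s) ⟨
    ζ S.∙ proj₁ (GModule._^_ S.ₑKˣ (w , wᵉ≈ε) s)    ∎)
  where
  module S = Setup f>0 k-finite kf/k e>0 q^f≡1[mod-e]
  open FiniteFieldExtension f>0 k-finite kf/k using (q>0; module FK)
  open SetoidReasoning S.setoid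
  s = geometric q f
  ζ = S.ιˣ (S.norm α)
  ds≡N : (q ∸ 1) * s ≡ q ^ f ∸ 1
  ds≡N = [q-1]*geometric q f q>0
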